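{- Let $p$ be a prime, let $H$ be a positive integer and let $\mathcal U\subset \mathbb F_p^*$ satisfy $|\mathcal U\cdot\mathcal U|<10|\mathcal U|$. Let $J$ be the number of solutions of the congruence $$x\equiv yr \pmod p,\qquad x,y\in\mathbb N,\quad x,y\le H,\quad r\in\mathcal U.$$ Then: (i) If for some fixed positive integer $n$ we have $|\mathcal U|<p^{n/(2n+1)}$ and $|\mathcal U|H^n<p$, then $J\lesssim H$. (ii) If $|\mathcal U|<p^{2/5}$, then $$J\lesssim H+\frac{|\mathcal U|H^2}{p}+\frac{|\mathcal U|^{3/4}H}{p^{1/4}}.$$
   Context: $\mathbb F_p$ is the field of residue classes modulo $p$, and $\mathcal A\cdot\mathcal B=\{ab: a\in\mathcal A, b\in\mathcal B\}$. The notation $A\lesssim B$ means $|A|<|B|p^{o(1)}$, i.e. for every $\eta>0$ there is a constant $c(\eta)$ (which in part (i) may also depend on $n$, but not on $p$, $H$ or $\mathcal U$) such that $|A|<c(\eta)|B|p^{\eta}$. -}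

module Defs where

open import Data.Nat using (ℕ; zero; suc; _+_; _*_; _%_; NonZero)
import Data.Nat as ℕ
open import Data.Fin using (Fin; toℕ)
open import Data.Fin.Properties using (any?)
open import Data.Fin.Subset using (Subset; _∈_; _∉_; inside; outside)
open import Data.Fin.Subset.Properties using (_∈?_)
open import Data.Vec using (tabulate)
open import Data.Vec using () renaming (sum to vsum)
open import Data.Product using (∃; ∃₂; _×_; _,_)
open import Relation.Nullary using (Dec; does; yes; no; _×-dec_)
open import Data.Bool using (if_then_else_)

-- Elements of F_p are represented by Fin p (residues 0..p-1).

InProd : (p : ℕ) → .{{_ : NonZero p}} → Subset p → Fin p → Set
InProd p U z = ∃₂ λ (a b : Fin p) → (a ∈ U × b ∈ U) × ((toℕ a * toℕ b) % p ≡ toℕ z)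
  where open import Relation.Binary.PropositionalEquality using (_≡_)

inProd? : (p : ℕ) → .{{_ : NonZero p}} → (U : Subset p) → (z : Fin p) → Dec (InProd p U z)
inProd? p U z =
  any? λ a → any? λ b → (a ∈? U ×-dec b ∈? U) ×-dec ((toℕ a * toℕ b) % p ℕ.≟ toℕ z)

prodSet : (p : ℕ) → .{{_ : NonZero p}} → Subset p → Subset p
prodSet p U = tabulate λ z → if does (inProd? p U z) then inside else outside

InUnits : (p : ℕ) → Subset p → Set
InUnits p U = ∀ (z : Fin p) → z ∈ U → toℕ z ≡ 0 → ⊥
  where open import Relation.Binary.PropositionalEquality using (_≡_)
        open import Data.Empty using (⊥)

-- J = #{(x, y, r) : 1 ≤ x, y ≤ H, r ∈ U, x ≡ y r (mod p)}.
-- x, y are encoded by i, j : Fin H as x = toℕ i + 1, y = toℕ j + 1.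
solCount : (p : ℕ) → .{{_ : NonZero p}} → (H : ℕ) → Subset p → ℕ
solCount p H U =
  vsum (tabulate λ (i : Fin H) → vsum (tabulate λ (j : Fin H) → vsum (tabulate λ (r : Fin p) →
    if does (r ∈? U ×-dec (suc (toℕ i) % p ℕ.≟ (suc (toℕ j) * toℕ r) % p)) then 1 else 0)))

{-# OPTIONS --safe #-}
module Submission where

-- Write a solution as (x , y) = d (a , b) with a, b coprime.  Then J = Σ_d S(H / d), where S(L) counts
-- the reduced fractions a / b of height at most L whose residue lies in U, so it suffices to bound S(L) / L.
--
-- Splitting the primes into numerator primes and denominator primes keeps all but a factor p^o(1) of these
-- fractions and makes every product of m of them automatically reduced.  By the divisor bound the S(L)^m
-- products represent ≳ S(L)^m distinct reduced fractions of height at most L^m, whose residues lie in U^m;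
-- here |U^m| ≤ 10^m |U| by Plünnecke's inequality.  A residue class contains at most 1 + 2 X² / p reduced
-- fractions of height at most X, because the determinant of two of them is a nonzero multiple of p.  Hence
--
--   S(L)^m ≲ |U| (1 + L^(2m) / p)   for every bounded m,
--
-- which gives S(L) ≲ L as soon as |U| ≤ L^m ≤ p / |U|.  If L is a small power of p the bound S(L) ≤ L²
-- suffices; otherwise the least m with |U| ≤ L^m is bounded, and it satisfies L^m ≤ p / |U| in part (i).
-- In part (ii) this can fail only for m = 1, which produces the term |U| H² / p, and for m = 2, where the
-- geometric mean of the bounds for m = 1 and m = 2 produces the term |U|^(3/4) H / p^(1/4).

open import Defs
open import Data.Bool using (true; false; if_then_else_)
open import Data.Fin using (Fin; zero; suc; toℕ; fromℕ<)
import Data.Fin.Properties as Fin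
open import Data.Fin.Properties using (toℕ-fromℕ<; toℕ-injective; toℕ<n)
open import Data.Fin.Subset using (Subset; inside; outside) renaming (_∈_ to _∈ˢ_)
open import Data.Fin.Subset.Properties using (∣p∣≤n) renaming (_∈?_ to _∈ˢ?_)
open import Data.List using (List; []; _∷_; [_]; _++_; map; length; filter; deduplicate; upTo; allFin; tabulate; cartesianProduct; cartesianProductWith)
import Data.List.Extrema
open import Data.List.Membership.Propositional using (_∈_; find)
open import Data.List.Membership.Propositional.Properties using (∈-++⁺ˡ; ∈-++⁺ʳ; ∈-++⁻; ∈-map⁺; ∈-map⁻; ∈-filter⁺; ∈-filter⁻; ∈-deduplicate⁺; ∈-deduplicate⁻; ∈-upTo⁺; ∈-upTo⁻; ∈-allFin; ∈-cartesianProduct⁺; ∈-cartesianProduct⁻; ∈-cartesianProductWith⁺; ∈-cartesianProductWith⁻)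
open import Data.List.Properties using (length-++; length-map; length-upTo; length-filter; length-tabulate; filter-++)
open import Data.List.Relation.Binary.Sublist.Propositional using (_⊆_; []; _∷_; _∷ʳ_; ⊆-trans; ⊆-refl)
open import Data.List.Relation.Binary.Sublist.Propositional.Properties using (filter-⊆; length-mono-≤; Any-resp-⊆; All-resp-⊆)
open import Data.List.Relation.Unary.All as All using (All; []; _∷_)
import Data.List.Relation.Unary.All.Properties as Allₚ
open import Data.List.Relation.Unary.AllPairs using ([]; _∷_)
open import Data.List.Relation.Unary.Any as Any using (here; there)
import Data.List.Relation.Unary.Unique.DecPropositional.Properties as DecUniq
open import Data.List.Relation.Unary.Unique.Propositional using (Unique)
import Data.List.Relation.Unary.Unique.Propositional.Properties as Uniq
open import Data.Nat using (ℕ; zero; suc; _+_; _*_; _∸_; _^_; _/_; _%_; _≤_; _<_; z≤n; s≤s; z<s; s≤s⁻¹; NonZero; >-nonZero; nonTrivial⇒n>1; n>1⇒nonTrivial; ∣_-_∣)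
open import Data.Nat.Coprimality using (Coprime; coprime-divisor; coprime?)
import Data.Nat.Coprimality as Coprimality
open import Data.Nat.Divisibility
open import Data.Nat.DivMod using (m≡m%n+[m/n]*n; m%n<n; m/n*n≤m; m/n*n≡m; m<n⇒m%n≡m; m<n⇒m/n≡0; m≥n⇒m/n>0; [m+kn]%n≡m%n; %-distribˡ-*; /-monoˡ-≤)
open import Data.Nat.GCD using (gcd; gcd[m,n]∣m; gcd[m,n]∣n; gcd[m,n]≢0)
open import Data.Nat.Induction using (<-rec)
open import Data.Nat.ListAction using (sum; product)
open import Data.Nat.Primality using (Prime; prime?; _Rough_; 2-rough; ¬prime[1]; euclidsLemma; prime⇒irreducible; prime⇒nonTrivial; prime⇒nonZero; productOfPrimes≥1; rough∧∣⇒rough; rough∧∣⇒prime; ∤⇒rough-suc)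
open import Data.Nat.Primality.Factorisation using (factorise; PrimeFactorisation)
open import Data.Nat.Properties
open import Data.Nat.Tactic.RingSolver using (solve-∀)
open import Data.Product using (Σ; _×_; _,_; proj₁; proj₂; ∃-syntax)
open import Data.Product.Properties using (≡-dec)
open import Data.Sum using (_⊎_; inj₁; inj₂)
open import Data.Vec using () renaming (sum to vsum; tabulate to vtabulate; [] to []ᵛ; _∷_ to _∷ᵛ_; here to hereᵛ; there to thereᵛ)
open import Data.Vec.Properties using (lookup∘tabulate; lookup⇒[]=)
open import Function using (_∘_; id)
open import Relation.Binary.Definitions using (DecidableEquality; tri<; tri≈; tri>)
open import Relation.Binary.PropositionalEquality using (_≡_; refl; sym; trans; cong; cong₂; subst; subst₂; module ≡-Reasoning)
open import Relation.Nullary using (¬_; Dec; yes; no; does; ¬?; _×-dec_; contradiction)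
open import Relation.Nullary.Decidable using (dec-true)
open import Relation.Unary using (Decidable)

-- The determinant argument counts reduced fractions only: the multiples of a single pair all lie in
-- one residue class. A product of reduced fractions may cancel, as 2/3 times 3/5 does, and this is
-- what forces the separation of the primes. If every prime is sent at random to the numerators or
-- to the denominators, a / b survives with probability 2^(-ω(ab)), which is p^(-o(1)); a
-- deterministic choice with the same yield is found one prime at a time by conditional
-- expectations.
--
-- Everything stays in the natural numbers. A loss p^o(1) is a number T with T^k at most C p for a
-- prescribed k, and an m-th root is replaced by a comparison of high powers in which the exponent m
-- is finally cancelled. Two separate losses arise, the logarithm of the sum over d and the divisor
-- function, each costing a factor p; working with the exponent 2k and taking a square root brings
-- them back to the one factor p that is allowed.

module Extrema = Data.List.Extrema ≤-totalOrder

-- Counting in lists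

module _ {A : Set} {P : A → Set} (P? : Decidable P) where

  length-partition : ∀ xs → length xs ≡ length (filter P? xs) + length (filter (λ x → ¬? (P? x)) xs)
  length-partition [] = refl
  length-partition (x ∷ xs) with does (P? x)
  ... | true  = cong suc (length-partition xs)
  ... | false = trans (cong suc (length-partition xs)) (sym (+-suc _ _))

  length-filter-filter : ∀ {R : A → Set} (R? : Decidable R) xs →
    length (filter P? (filter R? xs)) ≤ length (filter P? xs)
  length-filter-filter R? [] = z≤n
  length-filter-filter R? (x ∷ xs) with does (R? x)
  ... | true with does (P? x)
  ...   | true  = s≤s (length-filter-filter R? xs)
  ...   | false = length-filter-filter R? xs
  length-filter-filter R? (x ∷ xs) | false with does (P? x)
  ...   | true  = m≤n⇒m≤1+n (length-filter-filter R? xs)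
  ...   | false = length-filter-filter R? xs

Unique-constant⇒length≤1 : ∀ {A : Set} {xs : List A} → Unique xs →
  (∀ {x y} → x ∈ xs → y ∈ xs → x ≡ y) → length xs ≤ 1
Unique-constant⇒length≤1 {xs = []} _ _ = z≤n
Unique-constant⇒length≤1 {xs = x ∷ []} _ _ = s≤s z≤n
Unique-constant⇒length≤1 {xs = x ∷ y ∷ xs} ((x≢y ∷ _) ∷ _) const =
  contradiction (const (here refl) (there (here refl))) x≢y

module _ {A B : Set} {Q : A → B → Set} (Q? : ∀ x y → Dec (Q x y)) where

  -- Induction on `ys`: the fibre of the first `y` is removed from `xs`, and the rest is covered by
  -- the other elements. A relation in place of a map lets residues be counted without choosing one
  -- for each fraction.
  length-cover : ∀ c xs ys → (∀ {x} → x ∈ xs → ∃[ y ] y ∈ ys × Q x y) →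
    (∀ {y} → y ∈ ys → length (filter (λ x → Q? x y) xs) ≤ c) → length xs ≤ length ys * c
  length-cover c [] [] cov fib = z≤n
  length-cover c (x ∷ xs) [] cov fib with () ← proj₁ (proj₂ (cov (here refl)))
  length-cover c xs (y ∷ ys) cov fib = begin
    length xs ≡⟨ length-partition Qy? xs ⟩
    length (filter Qy? xs) + length rest ≤⟨ +-mono-≤ (fib (here refl)) (length-cover c rest ys cov′ fib′) ⟩
    c + length ys * c ∎
    where
    open ≤-Reasoning
    Qy? : Decidable (λ x → Q x y)
    Qy? x = Q? x y
    rest = filter (λ x → ¬? (Qy? x)) xs
    cov′ : ∀ {x} → x ∈ rest → ∃[ y ] y ∈ ys × Q x y
    cov′ x∈ with ∈-filter⁻ (λ x → ¬? (Qy? x)) x∈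
    ... | x∈xs , ¬q with cov x∈xs
    ...   | _ , here refl , q = contradiction q ¬q
    ...   | z , there z∈ , q = z , z∈ , q
    fib′ : ∀ {z} → z ∈ ys → length (filter (λ x → Q? x z) rest) ≤ c
    fib′ {z} z∈ = ≤-trans (length-filter-filter (λ x → Q? x z) (λ x → ¬? (Qy? x)) xs) (fib (there z∈))

  length-injective : ∀ xs ys → Unique xs → (∀ {x} → x ∈ xs → ∃[ y ] y ∈ ys × Q x y) →
    (∀ {x x′ y} → x ∈ xs → x′ ∈ xs → Q x y → Q x′ y → x ≡ x′) → length xs ≤ length ys
  length-injective xs ys uniq cov inj = subst (length xs ≤_) (*-identityʳ _)
    (length-cover 1 xs ys cov λ {y} _ → Unique-constant⇒length≤1 (Uniq.filter⁺ (λ x → Q? x y) uniq) λ x∈ x′∈ →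
      let x∈xs , q = ∈-filter⁻ (λ x → Q? x y) x∈ ; x′∈xs , q′ = ∈-filter⁻ (λ x → Q? x y) x′∈ in
      inj x∈xs x′∈xs q q′)

module _ {A B : Set} (_≟_ : DecidableEquality B) (f : A → B) where

  length-map-injective : ∀ xs ys → Unique xs → (∀ {x} → x ∈ xs → f x ∈ ys) →
    (∀ {x x′} → x ∈ xs → x′ ∈ xs → f x ≡ f x′ → x ≡ x′) → length xs ≤ length ys
  length-map-injective xs ys uniq into inj = length-injective (λ x y → f x ≟ y) xs ys uniq
    (λ x∈ → _ , into x∈ , refl) (λ x∈ x′∈ e e′ → inj x∈ x′∈ (trans e (sym e′)))

module Card {A : Set} (_≟_ : DecidableEquality A) where

  card : List A → ℕ
  card xs = length (deduplicate _≟_ xs)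

  length-⊆ : ∀ {xs ys} → Unique xs → (∀ {x} → x ∈ xs → x ∈ ys) → length xs ≤ length ys
  length-⊆ uniq sub = length-map-injective _≟_ (λ x → x) _ _ uniq sub (λ _ _ e → e)

  length≤card : ∀ {xs ys} → Unique xs → (∀ {x} → x ∈ xs → x ∈ ys) → length xs ≤ card ys
  length≤card uniq sub = length-⊆ uniq (λ x∈ → ∈-deduplicate⁺ _≟_ (sub x∈))

  card≤length : ∀ {xs ys} → (∀ {x} → x ∈ xs → x ∈ ys) → card xs ≤ length ys
  card≤length {xs} sub = length-⊆ (DecUniq.deduplicate-! _≟_ xs) (λ x∈ → sub (∈-deduplicate⁻ _≟_ xs x∈))

  card-mono : ∀ {xs ys} → (∀ {x} → x ∈ xs → x ∈ ys) → card xs ≤ card ys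
  card-mono {xs} {ys} sub = card≤length {xs} λ x∈ → ∈-deduplicate⁺ _≟_ (sub x∈)

-- Plünnecke's inequality

-- The finite family of candidates over which `optimalSubset` minimises.
sublists : ∀ {A : Set} → List A → List (List A)
sublists [] = [ [] ]
sublists (x ∷ xs) = map (x ∷_) (sublists xs) ++ sublists xs

∈-sublists⁺ : ∀ {A : Set} {xs ys : List A} → ys ⊆ xs → ys ∈ sublists xs
∈-sublists⁺ [] = here refl
∈-sublists⁺ {xs = x ∷ xs} (.x ∷ʳ s) = ∈-++⁺ʳ (map (x ∷_) (sublists xs)) (∈-sublists⁺ s)
∈-sublists⁺ (refl ∷ s) = ∈-++⁺ˡ (∈-map⁺ _ (∈-sublists⁺ s))

∈-sublists⁻ : ∀ {A : Set} {xs ys : List A} → ys ∈ sublists xs → ys ⊆ xs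
∈-sublists⁻ {xs = []} (here refl) = []
∈-sublists⁻ {xs = x ∷ xs} ys∈ with ∈-++⁻ (map (x ∷_) (sublists xs)) ys∈
... | inj₁ i with _ , zs∈ , refl ← ∈-map⁻ (x ∷_) i = refl ∷ ∈-sublists⁻ zs∈
... | inj₂ i = x ∷ʳ ∈-sublists⁻ i

Unique-resp-⊆ : ∀ {A : Set} {xs ys : List A} → ys ⊆ xs → Unique xs → Unique ys
Unique-resp-⊆ [] [] = []
Unique-resp-⊆ (_ ∷ʳ s) (_ ∷ u) = Unique-resp-⊆ s u
Unique-resp-⊆ (refl ∷ s) (x∉ ∷ u) = All-resp-⊆ s x∉ ∷ Unique-resp-⊆ s u

module ProductSets {A : Set} (_≟_ : DecidableEquality A) (_∙_ : A → A → A) (e : A)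
  (assoc : ∀ x y z → (x ∙ y) ∙ z ≡ x ∙ (y ∙ z)) (comm : ∀ x y → x ∙ y ≡ y ∙ x)
  (identityˡ : ∀ x → e ∙ x ≡ x) where

  open Card _≟_
  open import Data.List.Membership.DecPropositional _≟_ using (_∈?_)

  infixr 7 _⊗_
  _⊗_ : List A → List A → List A
  _⊗_ = cartesianProductWith _∙_

  ⊗⁺ : ∀ {xs ys x y} → x ∈ xs → y ∈ ys → x ∙ y ∈ xs ⊗ ys
  ⊗⁺ = ∈-cartesianProductWith⁺ _∙_

  ⊗⁻ : ∀ xs ys {z} → z ∈ xs ⊗ ys → ∃[ x ] ∃[ y ] x ∈ xs × y ∈ ys × z ≡ x ∙ y
  ⊗⁻ = ∈-cartesianProductWith⁻ _∙_

  -- Because of 0, multiplication on F_p gives only a monoid. Inverses are therefore replaced by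
  -- cancellation, asked of individual elements and inherited by products.
  Cancellable : A → Set
  Cancellable c = ∀ {x y} → c ∙ x ≡ c ∙ y → x ≡ y

  ∙-cancellable : ∀ {c d} → Cancellable c → Cancellable d → Cancellable (c ∙ d)
  ∙-cancellable {c} {d} cc cd {x} {y} eq = cd (cc (trans (sym (assoc c d x)) (trans eq (assoc c d y))))

  ⊗-cancellable : ∀ {xs ys} → (∀ {x} → x ∈ xs → Cancellable x) → (∀ {y} → y ∈ ys → Cancellable y) →
    ∀ {z} → z ∈ xs ⊗ ys → Cancellable z
  ⊗-cancellable {xs} {ys} cx cy z∈ with x , y , x∈ , y∈ , refl ← ⊗⁻ xs ys z∈ = ∙-cancellable (cx x∈) (cy y∈)

  -- The submodularity step of Petridis's argument.
  module _ (c : A) (C X B : List A) where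

    private
      W = filter (λ x → (c ∙ x) ∈? (C ⊗ X)) X

    -- Since `c ∙ w` already lies in `C ⊗ X` for `w` in `W`, an element that is new in the larger
    -- product is `c ∙ y` with `y` in `X ⊗ B` but outside `W ⊗ B`.
    card-⊗-step-≤ : card ((c ∷ C) ⊗ X ⊗ B) + card (W ⊗ B) ≤ card (C ⊗ X ⊗ B) + card (X ⊗ B)
    card-⊗-step-≤ = begin
      length D + card (W ⊗ B) ≡⟨ cong (_+ card (W ⊗ B)) (length-partition old? D) ⟩
      length (filter old? D) + length (filter (λ d → ¬? (old? d)) D) + card (W ⊗ B)
        ≤⟨ +-mono-≤ (+-mono-≤ old≤ new≤) WB≤ ⟩
      card (C ⊗ X ⊗ B) + length (filter (λ y → ¬? (inWB? y)) E) + length (filter inWB? E)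
        ≡⟨ +-assoc (card (C ⊗ X ⊗ B)) _ _ ⟩
      card (C ⊗ X ⊗ B) + (length (filter (λ y → ¬? (inWB? y)) E) + length (filter inWB? E))
        ≡⟨ cong (card (C ⊗ X ⊗ B) +_) (+-comm (length (filter (λ y → ¬? (inWB? y)) E)) _) ⟩
      card (C ⊗ X ⊗ B) + (length (filter inWB? E) + length (filter (λ y → ¬? (inWB? y)) E))
        ≡⟨ cong (card (C ⊗ X ⊗ B) +_) (length-partition inWB? E) ⟨
      card (C ⊗ X ⊗ B) + length E ∎
      where
      open ≤-Reasoning
      D = deduplicate _≟_ ((c ∷ C) ⊗ X ⊗ B)
      E = deduplicate _≟_ (X ⊗ B)
      old? = _∈? (C ⊗ X ⊗ B)
      inWB? = _∈? (W ⊗ B)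
      D! = DecUniq.deduplicate-! _≟_ ((c ∷ C) ⊗ X ⊗ B)
      old≤ : length (filter old? D) ≤ card (C ⊗ X ⊗ B)
      old≤ = length≤card (Uniq.filter⁺ old? D!) (λ x∈ → proj₂ (∈-filter⁻ old? {xs = D} x∈))
      W-old : ∀ {y} → y ∈ W ⊗ B → c ∙ y ∈ C ⊗ X ⊗ B
      W-old y∈ with w , b , w∈ , b∈ , refl ← ⊗⁻ W B y∈
        with c′ , x , c′∈ , x∈ , eq ← ⊗⁻ C X (proj₂ (∈-filter⁻ (λ x → (c ∙ x) ∈? (C ⊗ X)) {xs = X} w∈)) =
        subst (_∈ C ⊗ X ⊗ B) (sym (trans (sym (assoc c w b)) (trans (cong (_∙ b) eq) (assoc c′ x b))))
          (⊗⁺ c′∈ (⊗⁺ x∈ b∈))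
      new≤ : length (filter (λ d → ¬? (old? d)) D) ≤ length (filter (λ y → ¬? (inWB? y)) E)
      new≤ = length-injective (λ d y → d ≟ (c ∙ y)) _ _ (Uniq.filter⁺ (λ d → ¬? (old? d)) D!) into
        (λ _ _ eq eq′ → trans eq (sym eq′))
        where
        into : ∀ {d} → d ∈ filter (λ d → ¬? (old? d)) D → ∃[ y ] y ∈ filter (λ y → ¬? (inWB? y)) E × d ≡ c ∙ y
        into d∈ with d∈D , new ← ∈-filter⁻ (λ d → ¬? (old? d)) {xs = D} d∈
          with ⊗⁻ (c ∷ C) (X ⊗ B) (∈-deduplicate⁻ _≟_ ((c ∷ C) ⊗ X ⊗ B) d∈D)
        ... | _ , y , here refl , y∈ , refl = y ,
          ∈-filter⁺ (λ y → ¬? (inWB? y)) (∈-deduplicate⁺ _≟_ y∈) (λ y∈WB → new (W-old y∈WB)) , refl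
        ... | _ , y , there c′∈ , y∈ , refl = contradiction (⊗⁺ c′∈ y∈) new
      WB≤ : card (W ⊗ B) ≤ length (filter inWB? E)
      WB≤ = card≤length {W ⊗ B} λ y∈ → ∈-filter⁺ inWB? (∈-deduplicate⁺ _≟_ (W⊗B⊆X⊗B y∈)) y∈
        where
        W⊗B⊆X⊗B : ∀ {y} → y ∈ W ⊗ B → y ∈ X ⊗ B
        W⊗B⊆X⊗B y∈ with w , b , w∈ , b∈ , refl ← ⊗⁻ W B y∈ =
          ⊗⁺ (proj₁ (∈-filter⁻ (λ x → (c ∙ x) ∈? (C ⊗ X)) {xs = X} w∈)) b∈

    -- The elements of `X` outside `W` give products `c ∙ x` outside `C ⊗ X`, distinct because `c`
    -- cancels.
    card-⊗-step-≥ : Unique X → Cancellable c → card (C ⊗ X) + length X ≤ card ((c ∷ C) ⊗ X) + length W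
    card-⊗-step-≥ X! cc = begin
      card (C ⊗ X) + length X ≡⟨ cong (card (C ⊗ X) +_) (length-partition inW? X) ⟩
      card (C ⊗ X) + (length W + length X∖W) ≡⟨ cong (card (C ⊗ X) +_) (+-comm (length W) _) ⟩
      card (C ⊗ X) + (length X∖W + length W) ≡⟨ +-assoc (card (C ⊗ X)) _ _ ⟨
      card (C ⊗ X) + length X∖W + length W ≤⟨ +-monoˡ-≤ (length W) (+-mono-≤ old≥ new≥) ⟩
      length (filter old? D) + length (filter (λ d → ¬? (old? d)) D) + length W
        ≡⟨ cong (_+ length W) (length-partition old? D) ⟨
      length D + length W ∎
      where
      open ≤-Reasoning
      D = deduplicate _≟_ ((c ∷ C) ⊗ X)
      old? = _∈? (C ⊗ X)
      inW? = λ x → (c ∙ x) ∈? (C ⊗ X)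
      X∖W = filter (λ x → ¬? (inW? x)) X
      old≥ : card (C ⊗ X) ≤ length (filter old? D)
      old≥ = card≤length {C ⊗ X} λ y∈ → ∈-filter⁺ old? (∈-deduplicate⁺ _≟_ (∈-++⁺ʳ (map (c ∙_) X) y∈)) y∈
      new≥ : length X∖W ≤ length (filter (λ d → ¬? (old? d)) D)
      new≥ = length-map-injective _≟_ (c ∙_) _ _ (Uniq.filter⁺ (λ x → ¬? (inW? x)) X!)
        (λ x∈ → let x∈X , new = ∈-filter⁻ (λ x → ¬? (inW? x)) {xs = X} x∈ in
          ∈-filter⁺ (λ d → ¬? (old? d)) (∈-deduplicate⁺ _≟_ (⊗⁺ {xs = c ∷ C} (here refl) x∈X)) new)
        (λ _ _ → cc)

  module _ (K : ℕ) (X B : List A) (X! : Unique X)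
    (opt : ∀ {Z} → Z ⊆ X → card (X ⊗ B) + K * length Z ≤ card (Z ⊗ B) + K * length X) where

    -- Adjoining `c` to `C` raises the left side by at most |XB| - |WB| and |CX| by at least |X| -
    -- |W|. Optimality of `X`, tested on `W`, says that the first difference is at most `K` times
    -- the second.
    petridis : ∀ C → (∀ {c} → c ∈ C → Cancellable c) → card (C ⊗ X ⊗ B) ≤ K * card (C ⊗ X)
    petridis [] _ = z≤n
    petridis (c ∷ C) canc = +-cancelʳ-≤ (card (W ⊗ B) + K * length W) _ _ (begin
      card ((c ∷ C) ⊗ X ⊗ B) + (card (W ⊗ B) + K * length W) ≡⟨ +-assoc (card ((c ∷ C) ⊗ X ⊗ B)) _ _ ⟨
      card ((c ∷ C) ⊗ X ⊗ B) + card (W ⊗ B) + K * length W ≤⟨ +-monoˡ-≤ _ (card-⊗-step-≤ c C X B) ⟩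
      card (C ⊗ X ⊗ B) + card (X ⊗ B) + K * length W
        ≤⟨ +-monoˡ-≤ _ (+-monoˡ-≤ _ (petridis C (λ c∈ → canc (there c∈)))) ⟩
      K * card (C ⊗ X) + card (X ⊗ B) + K * length W ≡⟨ +-assoc (K * card (C ⊗ X)) _ _ ⟩
      K * card (C ⊗ X) + (card (X ⊗ B) + K * length W) ≤⟨ +-monoʳ-≤ (K * card (C ⊗ X)) (opt (filter-⊆ (λ x → (c ∙ x) ∈? (C ⊗ X)) X)) ⟩
      K * card (C ⊗ X) + (card (W ⊗ B) + K * length X) ≡⟨ solve₁ K (card (C ⊗ X)) (card (W ⊗ B)) (length X) ⟩
      K * (card (C ⊗ X) + length X) + card (W ⊗ B)
        ≤⟨ +-monoˡ-≤ _ (*-monoʳ-≤ K (card-⊗-step-≥ c C X B X! (canc (here refl)))) ⟩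
      K * (card ((c ∷ C) ⊗ X) + length W) + card (W ⊗ B)
        ≡⟨ solve₂ K (card ((c ∷ C) ⊗ X)) (card (W ⊗ B)) (length W) ⟩
      K * card ((c ∷ C) ⊗ X) + (card (W ⊗ B) + K * length W) ∎)
      where
      open ≤-Reasoning
      W = filter (λ x → (c ∙ x) ∈? (C ⊗ X)) X
      solve₁ : ∀ k a b x → k * a + (b + k * x) ≡ k * (a + x) + b
      solve₁ = solve-∀
      solve₂ : ∀ k a b x → k * (a + x) + b ≡ k * a + (b + k * x)
      solve₂ = solve-∀

  -- Minimising |ZB| − K |Z| rather than |ZB| / |Z| keeps the argument linear.
  optimalSubset : ∀ K U B → ∃[ X ] X ⊆ U ×
    (∀ {Z} → Z ⊆ U → card (X ⊗ B) + K * length Z ≤ card (Z ⊗ B) + K * length X)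
  optimalSubset K U B = X , X⊆U , opt
    where
    open ≤-Reasoning
    h : List A → ℕ
    -- The constant `K * length U` is added so that the objective |ZB| - K |Z| is a natural number.
    h Z = card (Z ⊗ B) + K * (length U ∸ length Z)
    X = Extrema.argmin h U (sublists U)
    X⊆U : X ⊆ U
    X⊆U with Extrema.argmin-sel h U (sublists U)
    ... | inj₁ eq rewrite eq = ⊆-refl
    ... | inj₂ i = ∈-sublists⁻ i
    opt : ∀ {Z} → Z ⊆ U → card (X ⊗ B) + K * length Z ≤ card (Z ⊗ B) + K * length X
    opt {Z} Z⊆U = +-cancelʳ-≤ (K * length U) _ _ (begin
      card (X ⊗ B) + K * length Z + K * length U
        ≡⟨ cong (λ t → card (X ⊗ B) + K * length Z + K * t) (m∸n+n≡m (length-mono-≤ X⊆U)) ⟨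
      card (X ⊗ B) + K * length Z + K * (length U ∸ length X + length X)
        ≡⟨ solve₁ (card (X ⊗ B)) K (length Z) (length U ∸ length X) (length X) ⟩
      h X + K * (length Z + length X)
        ≤⟨ +-monoˡ-≤ (K * (length Z + length X)) (All.lookup (Extrema.f[argmin]≤f[xs] {f = h} U (sublists U)) (∈-sublists⁺ Z⊆U)) ⟩
      h Z + K * (length Z + length X)
        ≡⟨ solve₂ (card (Z ⊗ B)) K (length Z) (length U ∸ length Z) (length X) ⟩
      card (Z ⊗ B) + K * length X + K * (length U ∸ length Z + length Z)
        ≡⟨ cong (λ t → card (Z ⊗ B) + K * length X + K * t) (m∸n+n≡m (length-mono-≤ Z⊆U)) ⟩
      card (Z ⊗ B) + K * length X + K * length U ∎)
      where
      solve₁ : ∀ a k z u x → a + k * z + k * (u + x) ≡ a + k * u + k * (z + x)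
      solve₁ = solve-∀
      solve₂ : ∀ a k z u x → a + k * u + k * (z + x) ≡ a + k * x + k * (u + z)
      solve₂ = solve-∀

  power : List A → ℕ → List A
  power U zero = [ e ]
  power U (suc m) = U ⊗ power U m

  module _ (K : ℕ) (U : List A) (U! : Unique U) (canc : ∀ {u} → u ∈ U → Cancellable u)
    (doubling : card (U ⊗ U) < K * length U) where

    power-cancellable : ∀ m {z} → z ∈ power U m → Cancellable z
    power-cancellable zero (here refl) eq = trans (sym (identityˡ _)) (trans eq (identityˡ _))
    power-cancellable (suc m) = ⊗-cancellable canc (power-cancellable m)

    -- By `petridis` with C = `power U m`, every further factor `U` multiplies |U^m X| by at most
    -- `K`. A translate of U^m by one element of `X` lies in U^m X, and |X| is at most |U|.
    plünnecke : ∀ m → card (power U m) ≤ K ^ m * length U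
    plünnecke m = let X , X⊆U , opt = optimalSubset K U U in main X X⊆U opt
      where
      open ≤-Reasoning
      main : ∀ X → X ⊆ U → (∀ {Z} → Z ⊆ U → card (X ⊗ U) + K * length Z ≤ card (Z ⊗ U) + K * length X) →
        card (power U m) ≤ K ^ m * length U
      -- The empty set gives the objective |ZU| - K |Z| the value 0, while `U` makes it negative by
      -- the strict inequality in `doubling`.
      main [] X⊆U opt = contradiction doubling (≤⇒≯ (subst (K * length U ≤_)
        (trans (cong (card (U ⊗ U) +_) (*-zeroʳ K)) (+-identityʳ _)) (opt ⊆-refl)))
      main X@(x ∷ _) X⊆U opt = begin
        card (power U m) ≤⟨ length-map-injective _≟_ (x ∙_) _ _ (DecUniq.deduplicate-! _≟_ (power U m))
          (λ y∈ → ∈-deduplicate⁺ _≟_ (subst (_∈ power U m ⊗ X) (comm _ x)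
            (⊗⁺ {ys = X} (∈-deduplicate⁻ _≟_ (power U m) y∈) (here refl))))
          (λ _ _ → canc (Any-resp-⊆ X⊆U (here refl))) ⟩
        card (power U m ⊗ X) ≤⟨ growth m ⟩
        K ^ m * length X ≤⟨ *-monoʳ-≤ (K ^ m) (length-mono-≤ X⊆U) ⟩
        K ^ m * length U ∎
        where
        growth : ∀ m → card (power U m ⊗ X) ≤ K ^ m * length X
        growth zero = ≤-trans (card≤length {[ e ] ⊗ X} into) (≤-reflexive (sym (+-identityʳ _)))
          where
          into : ∀ {z} → z ∈ [ e ] ⊗ X → z ∈ X
          into z∈ with _ , y , here refl , y∈ , refl ← ⊗⁻ [ e ] X z∈ = subst (_∈ X) (sym (identityˡ y)) y∈
        growth (suc m) = begin
          card ((U ⊗ power U m) ⊗ X) ≤⟨ card-mono {(U ⊗ power U m) ⊗ X} into ⟩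
          card (power U m ⊗ X ⊗ U) ≤⟨ petridis K X U (Unique-resp-⊆ X⊆U U!) (λ Z⊆X → opt (⊆-trans Z⊆X X⊆U))
            (power U m) (power-cancellable m) ⟩
          K * card (power U m ⊗ X) ≤⟨ *-monoʳ-≤ K (growth m) ⟩
          K * (K ^ m * length X) ≡⟨ *-assoc K _ _ ⟨
          K ^ suc m * length X ∎
          where
          into : ∀ {z} → z ∈ (U ⊗ power U m) ⊗ X → z ∈ power U m ⊗ X ⊗ U
          into z∈ with _ , y , v∈ , y∈ , refl ← ⊗⁻ (U ⊗ power U m) X z∈
            with u , v , u∈ , v∈ , refl ← ⊗⁻ U (power U m) v∈ =
            subst (_∈ power U m ⊗ X ⊗ U) (sym (trans (assoc u v y) (trans (comm u (v ∙ y)) (assoc v y u))))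
              (⊗⁺ v∈ (⊗⁺ y∈ u∈))

-- Divisor bounds

^-distribʳ-* : ∀ k m n → (m * n) ^ k ≡ m ^ k * n ^ k
^-distribʳ-* zero m n = refl
^-distribʳ-* (suc k) m n = trans (cong (m * n *_) (^-distribʳ-* k m n)) (solve₁ m n (m ^ k) (n ^ k))
  where
  solve₁ : ∀ a b c d → a * b * (c * d) ≡ a * c * (b * d)
  solve₁ = solve-∀

^-positive : ∀ m n → 1 ≤ m → 1 ≤ m ^ n
^-positive m n 1≤m = subst (_≤ m ^ n) (^-zeroˡ n) (^-monoˡ-≤ n 1≤m)

*-positive : ∀ {m n} → 1 ≤ m → 1 ≤ n → 1 ≤ m * n
*-positive = *-mono-≤

^-cancelˡ-≤ : ∀ n {x y} → 1 ≤ n → x ^ n ≤ y ^ n → x ≤ y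
^-cancelˡ-≤ n@(suc _) {x} {y} 1≤n le = ≮⇒≥ λ y<x → <⇒≱ (^-monoˡ-< n y<x) le

n≤n^ : ∀ E n → 1 ≤ E → n ≤ n ^ E
n≤n^ E zero _ = z≤n
n≤n^ E n@(suc _) 1≤E = subst (_≤ n ^ E) (^-identityʳ n) (^-monoʳ-≤ n 1≤E)

n<2^n : ∀ n → n < 2 ^ n
n<2^n zero = s≤s z≤n
n<2^n (suc n) = subst (suc (suc n) ≤_) (cong (2 ^ n +_) (sym (+-identityʳ _)))
  (+-mono-≤ (^-positive 2 n (s≤s z≤n)) (n<2^n n))

-- With q = e / E one has e + 1 ≤ E (q + 1) ≤ E 2^q; then take E-th powers and use q E ≤ e.
polynomial≤exponential : ∀ E e → suc e ^ E ≤ E ^ E * 2 ^ e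
polynomial≤exponential zero e = subst (1 ≤_) (sym (+-identityʳ _)) (^-positive 2 e (s≤s z≤n))
polynomial≤exponential E@(suc _) e = begin
  suc e ^ E ≤⟨ ^-monoˡ-≤ E e<E*2^q ⟩
  (E * 2 ^ q) ^ E ≡⟨ ^-distribʳ-* E E (2 ^ q) ⟩
  E ^ E * (2 ^ q) ^ E ≡⟨ cong (E ^ E *_) (^-*-assoc 2 q E) ⟩
  E ^ E * 2 ^ (q * E) ≤⟨ *-monoʳ-≤ (E ^ E) (^-monoʳ-≤ 2 (m/n*n≤m e E)) ⟩
  E ^ E * 2 ^ e ∎
  where
  open ≤-Reasoning
  q = e / E
  e<E*2^q : e < E * 2 ^ q
  e<E*2^q = begin-strict
    e ≡⟨ m≡m%n+[m/n]*n e E ⟩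
    e % E + q * E <⟨ +-monoˡ-< (q * E) (m%n<n e E) ⟩
    E + q * E ≡⟨ *-comm (suc q) E ⟩
    E * suc q ≤⟨ *-monoʳ-≤ E (n<2^n q) ⟩
    E * 2 ^ q ∎

-- The integer part of the E-th root, found by descending search from `M`, which is high enough
-- because x ≤ x^E. Its maximality turns bounds on E-th powers into bounds by one number `t`.
integerRoot : ∀ E M → 1 ≤ E → 1 ≤ M → ∃[ t ] 1 ≤ t × t ^ E ≤ M × (∀ x → x ^ E ≤ M → x ≤ t)
integerRoot E M 1≤E 1≤M = let t , 1≤t , t^E≤M , max = search M in t , 1≤t , t^E≤M , λ x x^E≤M → max x x^E≤M (≤-trans (n≤n^ E x 1≤E) x^E≤M)
  where
  search : ∀ b → ∃[ t ] 1 ≤ t × t ^ E ≤ M × (∀ x → x ^ E ≤ M → x ≤ b → x ≤ t)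
  search zero = 1 , s≤s z≤n , subst (_≤ M) (sym (^-zeroˡ E)) 1≤M , λ x _ x≤0 → ≤-trans x≤0 z≤n
  search (suc b) with suc b ^ E ≤? M
  ... | yes le = suc b , s≤s z≤n , le , λ x _ x≤ → x≤
  ... | no ¬le with t , 1≤t , t^E≤M , max ← search b = t , 1≤t , t^E≤M , max′
    where
    max′ : ∀ x → x ^ E ≤ M → x ≤ suc b → x ≤ t
    max′ x x^E≤M x≤ with m≤n⇒m<n∨m≡n x≤
    ... | inj₁ (s≤s x≤b) = max x x^E≤M x≤b
    ... | inj₂ refl = contradiction x^E≤M ¬le

primeFactor : ∀ n → 1 < n → ∃[ q ] ∃[ n′ ] Prime q × 1 ≤ n′ × n ≡ q * n′
primeFactor n 1<n = go factors isFactorisation factorsPrime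
  where
  open PrimeFactorisation (factorise n {{>-nonZero (<-trans z<s 1<n)}})
  go : ∀ fs → n ≡ product fs → All Prime fs → ∃[ q ] ∃[ n′ ] Prime q × 1 ≤ n′ × n ≡ q * n′
  go [] n≡1 _ = contradiction (sym n≡1) (<⇒≢ 1<n)
  go (q ∷ fs) n≡ (q′ ∷ fs′) = q , product fs , q′ , productOfPrimes≥1 fs′ , n≡

prime>1 : ∀ {q} → Prime q → 1 < q
prime>1 {q} q′ = nonTrivial⇒n>1 q {{prime⇒nonTrivial q′}}

prime∤⇒coprime : ∀ {q n} → Prime q → ¬ q ∣ n → Coprime q n
prime∤⇒coprime q′ q∤n (d∣q , d∣n) with prime⇒irreducible q′ d∣q
... | inj₁ refl = refl
... | inj₂ refl = contradiction d∣n q∤n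

commonPrime⊎coprime : ∀ m n → 1 ≤ m → Coprime m n ⊎ ∃[ q ] Prime q × q ∣ m × q ∣ n
commonPrime⊎coprime m n 1≤m with coprime? m n
... | yes c = inj₁ c
... | no ¬c = inj₂ (go (gcd m n) refl)
  where
  go : ∀ g → g ≡ gcd m n → ∃[ q ] Prime q × q ∣ m × q ∣ n
  go zero eq = contradiction (0∣⇒≡0 (subst (_∣ m) (sym eq) (gcd[m,n]∣m m n))) (>⇒≢ 1≤m)
  go (suc zero) eq = contradiction (λ {i} → Coprimality.gcd≡1⇒coprime (sym eq) {i}) ¬c
  go g@(suc (suc _)) eq with q , g′ , q′ , _ , g≡ ← primeFactor g (s≤s (s≤s z≤n)) =
    q , q′ , ∣-trans q∣gcd (gcd[m,n]∣m m n) , ∣-trans q∣gcd (gcd[m,n]∣n m n)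
    where
    q∣gcd : q ∣ gcd m n
    q∣gcd = subst (q ∣_) (trans (sym g≡) eq) (m∣m*n g′)

divisors : ℕ → List ℕ
divisors n = filter (_∣? n) (upTo (suc n))

τ : ℕ → ℕ
τ n = length (divisors n)

∈-divisors⁺ : ∀ {d n} → 1 ≤ n → d ∣ n → d ∈ divisors n
∈-divisors⁺ {d} {n@(suc _)} 1≤n d∣n = ∈-filter⁺ (_∣? n) (∈-upTo⁺ (s≤s (∣⇒≤ d∣n))) d∣n

∈-divisors⁻ : ∀ {d n} → d ∈ divisors n → d ∣ n
∈-divisors⁻ {n = n} d∈ = proj₂ (∈-filter⁻ (_∣? n) {xs = upTo (suc n)} d∈)

divisors-! : ∀ n → Unique (divisors n)
divisors-! n = Uniq.filter⁺ (_∣? n) (Uniq.upTo⁺ (suc n))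

∣q^*⇒ : ∀ {q} → Prime q → ∀ e n {d} → d ∣ q ^ suc e * n → q ^ suc e ∣ d ⊎ d ∣ q ^ e * n
∣q^*⇒ {q} q′ e n {d} d∣ with q ∣? d
... | no q∤d = inj₂ (coprime-divisor (Coprimality.sym (prime∤⇒coprime q′ q∤d)) (subst (d ∣_) (*-assoc q (q ^ e) n) d∣))
∣q^*⇒ {q} q′ zero n d∣ | yes q∣d = inj₁ (subst (_∣ _) (sym (*-identityʳ q)) q∣d)
∣q^*⇒ {q} q′ (suc e) n {d} d∣ | yes (divides d′ refl)
  with ∣q^*⇒ q′ e n {d′} (*-cancelˡ-∣ q {{prime⇒nonZero q′}} (subst₂ _∣_ (*-comm d′ q) (*-assoc q (q ^ suc e) n) d∣))
... | inj₁ i = inj₁ (subst (q ^ suc (suc e) ∣_) (*-comm q d′) (*-monoʳ-∣ q i))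
... | inj₂ i = inj₂ (subst₂ _∣_ (*-comm q d′) (sym (*-assoc q (q ^ e) n)) (*-monoʳ-∣ q i))

-- By `∣q^*⇒` a divisor that does not divide q^e n is q^(e+1) times a divisor of `n`.
τ-q^suc* : ∀ {q} → Prime q → ∀ e n → 1 ≤ n → τ (q ^ suc e * n) ≤ τ (q ^ e * n) + τ n
τ-q^suc* {q} q′ e n 1≤n = begin
  τ m ≤⟨ length-⊆ (divisors-! m) (λ d∈ → into (∈-divisors⁻ d∈)) ⟩
  length (divisors (q ^ e * n) ++ map (c *_) (divisors n)) ≡⟨ length-++ (divisors (q ^ e * n)) ⟩
  τ (q ^ e * n) + length (map (c *_) (divisors n)) ≡⟨ cong (τ (q ^ e * n) +_) (length-map (c *_) (divisors n)) ⟩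
  τ (q ^ e * n) + τ n ∎
  where
  open ≤-Reasoning
  open Card _≟_
  1≤q = <⇒≤ (prime>1 q′)
  c = q ^ suc e
  m = c * n
  into : ∀ {d} → d ∣ m → d ∈ divisors (q ^ e * n) ++ map (c *_) (divisors n)
  into {d} d∣m with ∣q^*⇒ q′ e n d∣m
  ... | inj₂ d∣ = ∈-++⁺ˡ (∈-divisors⁺ (*-positive (^-positive q e 1≤q) 1≤n) d∣)
  ... | inj₁ (divides d′ refl) = ∈-++⁺ʳ (divisors (q ^ e * n)) (subst (_∈ map (c *_) (divisors n)) (*-comm c d′)
    (∈-map⁺ (c *_) (∈-divisors⁺ 1≤n (*-cancelˡ-∣ c {{>-nonZero (^-positive q (suc e) 1≤q)}} (subst (_∣ m) (*-comm d′ c) d∣m)))))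

τ-q^* : ∀ {q} → Prime q → ∀ e n → 1 ≤ n → τ (q ^ e * n) ≤ suc e * τ n
τ-q^* q′ zero n 1≤n = ≤-reflexive (trans (cong τ (+-identityʳ n)) (sym (+-identityʳ (τ n))))
τ-q^* {q} q′ (suc e) n 1≤n = ≤-trans (τ-q^suc* q′ e n 1≤n)
  (≤-trans (+-monoˡ-≤ (τ n) (τ-q^* q′ e n 1≤n)) (≤-reflexive (+-comm (suc e * τ n) (τ n))))

multiplicity : ∀ q → 1 < q → ∀ n → 1 ≤ n → ∃[ e ] ∃[ n′ ] n ≡ q ^ e * n′ × 1 ≤ n′ × ¬ q ∣ n′
multiplicity q 1<q = <-rec _ step
  where
  step : ∀ n → (∀ {m} → m < n → 1 ≤ m → ∃[ e ] ∃[ n′ ] m ≡ q ^ e * n′ × 1 ≤ n′ × ¬ q ∣ n′) →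
    1 ≤ n → ∃[ e ] ∃[ n′ ] n ≡ q ^ e * n′ × 1 ≤ n′ × ¬ q ∣ n′
  step n rec 1≤n with q ∣? n
  ... | no q∤n = 0 , n , sym (+-identityʳ n) , 1≤n , q∤n
  ... | yes (divides zero refl) with () ← 1≤n
  ... | yes (divides m@(suc _) refl) with e , n′ , eq , 1≤n′ , q∤ ← rec (m<m*n m q 1<q) (s≤s z≤n) =
    suc e , n′ , trans (*-comm m q) (trans (cong (q *_) eq) (sym (*-assoc q (q ^ e) n′))) , 1≤n′ , q∤

-- Removing a prime factor `q` at worst halves τ, which costs 2^E after taking E-th powers, and
-- roughness gives q ≥ B ≥ 2^E.
τ-rough-bound : ∀ E B → 2 ^ E ≤ B → ∀ n → 1 ≤ n → B Rough n → τ n ^ E ≤ n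
τ-rough-bound E B 2^E≤B = <-rec _ step
  where
  open ≤-Reasoning
  step : ∀ n → (∀ {m} → m < n → 1 ≤ m → B Rough m → τ m ^ E ≤ m) → 1 ≤ n → B Rough n → τ n ^ E ≤ n
  step (suc zero) rec _ _ = ≤-reflexive (^-zeroˡ E)
  step n@(suc (suc _)) rec _ rough with q , m , q′ , 1≤m , n≡ ← primeFactor n (s≤s (s≤s z≤n)) = begin
    τ n ^ E ≡⟨ cong (λ z → τ z ^ E) (trans n≡ (cong (_* m) (sym (*-identityʳ q)))) ⟩
    τ (q ^ 1 * m) ^ E ≤⟨ ^-monoˡ-≤ E (τ-q^* q′ 1 m 1≤m) ⟩
    (2 * τ m) ^ E ≡⟨ ^-distribʳ-* E 2 (τ m) ⟩
    2 ^ E * τ m ^ E ≤⟨ *-mono-≤ (≤-trans 2^E≤B B≤q) (rec m<n 1≤m (rough∧∣⇒rough rough m∣n)) ⟩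
    q * m ≡⟨ n≡ ⟨
    n ∎
    where
    m∣n : m ∣ n
    m∣n = divides q n≡
    B≤q : B ≤ q
    B≤q = ≮⇒≥ λ q<B → rough (hasNonTrivialDivisor {{prime⇒nonTrivial q′}} q<B (divides m (trans n≡ (*-comm q m))))
    m<n : m < n
    m<n = subst (m <_) (trans (*-comm m q) (sym n≡)) (m<m*n m q {{>-nonZero 1≤m}} (prime>1 q′))

-- Induction on `j`, which bounds the distance from `B` up to 2^E. Removing the exact power B^e
-- costs (e + 1)^E ≤ E^E B^e, hence a constant for each prime below 2^E; the primes from 2^E on cost
-- nothing. A `B` dividing a `B`-rough number is prime.
τ-bound-from : ∀ E j B → 2 ≤ B → 2 ^ E ≤ j + B → ∃[ C ] (∀ n → 1 ≤ n → B Rough n → τ n ^ E ≤ C * n)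
τ-bound-from E zero B _ 2^E≤B = 1 , λ n 1≤n rough → ≤-trans (τ-rough-bound E B 2^E≤B n 1≤n rough) (≤-reflexive (sym (+-identityʳ n)))
τ-bound-from E (suc j) B 2≤B le
  with C , bound ← τ-bound-from E j (suc B) (m≤n⇒m≤1+n 2≤B) (subst (2 ^ E ≤_) (sym (+-suc j B)) le) =
  E ^ E * C , bound′
  where
  open ≤-Reasoning
  1≤E^E : 1 ≤ E ^ E
  1≤E^E = subst (1 ≤_) (*-identityʳ _) (≤-trans (^-positive 1 E (s≤s z≤n)) (polynomial≤exponential E 0))
  bound′ : ∀ n → 1 ≤ n → B Rough n → τ n ^ E ≤ E ^ E * C * n
  bound′ n 1≤n rough with B ∣? n
  ... | no B∤n = begin
    τ n ^ E ≤⟨ bound n 1≤n (∤⇒rough-suc B∤n rough) ⟩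
    C * n ≡⟨ +-identityʳ _ ⟨
    1 * (C * n) ≤⟨ *-monoˡ-≤ (C * n) 1≤E^E ⟩
    E ^ E * (C * n) ≡⟨ *-assoc (E ^ E) C n ⟨
    E ^ E * C * n ∎
  ... | yes B∣n with e , m , n≡ , 1≤m , B∤m ← multiplicity B 2≤B n 1≤n = begin
    τ n ^ E ≡⟨ cong (λ z → τ z ^ E) n≡ ⟩
    τ (B ^ e * m) ^ E ≤⟨ ^-monoˡ-≤ E (τ-q^* (rough∧∣⇒prime {{n>1⇒nonTrivial 2≤B}} rough B∣n) e m 1≤m) ⟩
    (suc e * τ m) ^ E ≡⟨ ^-distribʳ-* E (suc e) (τ m) ⟩
    suc e ^ E * τ m ^ E ≤⟨ *-mono-≤ (≤-trans (polynomial≤exponential E e) (*-monoʳ-≤ (E ^ E) (^-monoˡ-≤ e 2≤B)))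
      (bound m 1≤m (∤⇒rough-suc B∤m (rough∧∣⇒rough rough (divides (B ^ e) n≡)))) ⟩
    E ^ E * B ^ e * (C * m) ≡⟨ solve₁ (E ^ E) (B ^ e) C m ⟩
    E ^ E * C * (B ^ e * m) ≡⟨ cong (E ^ E * C *_) n≡ ⟨
    E ^ E * C * n ∎
    where
    solve₁ : ∀ a b c d → a * b * (c * d) ≡ a * c * (b * d)
    solve₁ = solve-∀

τ-bound : ∀ E → ∃[ C ] (∀ n → 1 ≤ n → τ n ^ E ≤ C * n)
τ-bound E with C , bound ← τ-bound-from E (2 ^ E) 2 ≤-refl (m≤m+n (2 ^ E) 2) =
  C , λ n 1≤n → bound n 1≤n 2-rough

product-primes-∣ : ∀ {qs} n → Unique qs → All Prime qs → All (_∣ n) qs → product qs ∣ n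
product-primes-∣ n [] [] [] = 1∣ n
product-primes-∣ {q ∷ qs} n (q∉ ∷ qs!) (q′ ∷ qs′) (divides m refl ∷ qs∣) =
  subst (q * product qs ∣_) (*-comm q m) (*-monoʳ-∣ q (product-primes-∣ m qs! qs′ (rest q∉ qs′ qs∣)))
  where
  rest : ∀ {rs} → All (λ r → ¬ q ≡ r) rs → All Prime rs → All (_∣ m * q) rs → All (_∣ m) rs
  rest [] [] [] = []
  rest (q≢r ∷ q≢) (r′ ∷ rs′) (r∣ ∷ rs∣) with euclidsLemma m q r′ r∣
  ... | inj₁ r∣m = r∣m ∷ rest q≢ rs′ rs∣
  ... | inj₂ r∣q with prime⇒irreducible q′ r∣q
  ...   | inj₁ refl = contradiction r′ ¬prime[1]
  ...   | inj₂ refl = contradiction refl q≢r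

ω : List ℕ → ℕ → ℕ
ω qs n = length (filter (_∣? n) qs)

-- Put Q = 2^E. At most Q of the primes lie below Q and contribute at most Q^Q together; each of the
-- others is at least Q, and their product divides `n`.
ω-bound : ∀ E qs n → Unique qs → All Prime qs → 1 ≤ n → (2 ^ ω qs n) ^ E ≤ (2 ^ E) ^ (2 ^ E) * n
ω-bound E qs n qs! qs′ 1≤n = begin
  (2 ^ length ds) ^ E ≡⟨ ^-*-assoc 2 (length ds) E ⟩
  2 ^ (length ds * E) ≡⟨ cong (2 ^_) (*-comm (length ds) E) ⟩
  2 ^ (E * length ds) ≡⟨ ^-*-assoc 2 E (length ds) ⟨
  Q ^ length ds ≡⟨ cong (Q ^_) (length-partition (_<? Q) ds) ⟩
  Q ^ (length small + length large) ≡⟨ ^-distribˡ-+-* Q (length small) (length large) ⟩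
  Q ^ length small * Q ^ length large ≤⟨ *-mono-≤ (^-monoʳ-≤ Q {{>-nonZero (^-positive 2 E (s≤s z≤n))}} small≤) (≤-trans (powers large large≥) large≤) ⟩
  Q ^ Q * n ∎
  where
  open ≤-Reasoning
  open Card _≟_
  Q = 2 ^ E
  ds = filter (_∣? n) qs
  small = filter (_<? Q) ds
  large = filter (λ q → ¬? (q <? Q)) ds
  ds! = Uniq.filter⁺ (_∣? n) qs!
  small≤ : length small ≤ Q
  small≤ = subst (length small ≤_) (length-upTo Q) (length-⊆ (Uniq.filter⁺ (_<? Q) ds!)
    (λ q∈ → ∈-upTo⁺ (proj₂ (∈-filter⁻ (_<? Q) {xs = ds} q∈))))
  large-∈ : ∀ {q} → q ∈ large → q ∈ qs × q ∣ n
  large-∈ q∈ = ∈-filter⁻ (_∣? n) {xs = qs} (proj₁ (∈-filter⁻ (λ q → ¬? (q <? Q)) {xs = ds} q∈))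
  large≥ : All (Q ≤_) large
  large≥ = All.tabulate λ q∈ → ≮⇒≥ (proj₂ (∈-filter⁻ (λ q → ¬? (q <? Q)) {xs = ds} q∈))
  large≤ : product large ≤ n
  large≤ = ∣⇒≤ {{>-nonZero 1≤n}} (product-primes-∣ n (Uniq.filter⁺ (λ q → ¬? (q <? Q)) ds!)
    (All.tabulate λ q∈ → All.lookup qs′ (proj₁ (large-∈ q∈))) (All.tabulate λ q∈ → proj₂ (large-∈ q∈)))
  powers : ∀ rs → All (Q ≤_) rs → Q ^ length rs ≤ product rs
  powers [] [] = ≤-refl
  powers (r ∷ rs) (Q≤r ∷ Q≤) = *-mono-≤ Q≤r (powers rs Q≤)

-- A single `t` of size about N^(1/E) serves both losses: τ bounds the ways to factor a product of
-- fractions, and 2^ω is the cost of separating the primes.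
divisorLoss : ∀ E → 1 ≤ E → ∃[ C ] (∀ N → 1 ≤ N → ∃[ t ] 1 ≤ t × t ^ E ≤ C * N ×
  (∀ {n} → 1 ≤ n → n ≤ N → τ n ≤ t) ×
  (∀ {n qs} → 1 ≤ n → n ≤ N → Unique qs → All Prime qs → 2 ^ ω qs n ≤ t))
divisorLoss E 1≤E with Cτ , boundτ ← τ-bound E = Cτ + Cω , loss
  where
  Cω = (2 ^ E) ^ (2 ^ E)
  1≤Cω : 1 ≤ Cω
  1≤Cω = ^-positive (2 ^ E) (2 ^ E) (^-positive 2 E (s≤s z≤n))
  loss : ∀ N → 1 ≤ N → ∃[ t ] 1 ≤ t × t ^ E ≤ (Cτ + Cω) * N ×
    (∀ {n} → 1 ≤ n → n ≤ N → τ n ≤ t) ×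
    (∀ {n qs} → 1 ≤ n → n ≤ N → Unique qs → All Prime qs → 2 ^ ω qs n ≤ t)
  loss N 1≤N with t , 1≤t , t^E≤ , max ← integerRoot E ((Cτ + Cω) * N) 1≤E (*-positive (≤-trans 1≤Cω (m≤n+m Cω Cτ)) 1≤N) =
    t , 1≤t , t^E≤ ,
    (λ {n} 1≤n n≤N → max _ (≤-trans (boundτ n 1≤n) (*-mono-≤ (m≤m+n Cτ Cω) n≤N))) ,
    (λ {n} {qs} 1≤n n≤N qs! qs′ → max _ (≤-trans (ω-bound E qs n qs! qs′ 1≤n) (*-mono-≤ (m≤n+m Cω Cτ) n≤N)))

-- Separating numerators from denominators

Pair : Set
Pair = ℕ × ℕ

_≟ₚ_ : (v w : Pair) → Dec (v ≡ w)
_≟ₚ_ = ≡-dec _≟_ _≟_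

-- For coprime `v` this is the number of assignments of the primes in `qs` to numerators or
-- denominators under which `v` survives: a prime dividing a coordinate leaves one choice, any other
-- prime leaves two.
weight : List ℕ → Pair → ℕ
weight [] v = 1
weight (q ∷ qs) v with q ∣? (proj₁ v * proj₂ v)
... | yes _ = weight qs v
... | no  _ = 2 * weight qs v

totalWeight : List ℕ → List Pair → ℕ
totalWeight qs A = sum (map (weight qs) A)

weight-ω : ∀ qs v → weight qs v * 2 ^ ω qs (proj₁ v * proj₂ v) ≡ 2 ^ length qs
weight-ω [] v = refl
weight-ω (q ∷ qs) v with q ∣? (proj₁ v * proj₂ v)
... | yes _ = trans (solve₁ (weight qs v) (2 ^ ω qs (proj₁ v * proj₂ v))) (cong (2 *_) (weight-ω qs v))
  where
  solve₁ : ∀ a b → a * (2 * b) ≡ 2 * (a * b)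
  solve₁ = solve-∀
... | no  _ = trans (*-assoc 2 (weight qs v) _) (cong (2 *_) (weight-ω qs v))

-- By coprimality a fraction with `q` in one coordinate lies in exactly one of the two filtered
-- lists. Any other fraction lies in both, which matches the factor 2 in its weight.
totalWeight-split : ∀ q qs A → ¬ q ≡ 1 → (∀ {v} → v ∈ A → Coprime (proj₁ v) (proj₂ v)) →
  totalWeight (q ∷ qs) A ≤ totalWeight qs (filter (λ v → ¬? (q ∣? proj₁ v)) A)
                         + totalWeight qs (filter (λ v → ¬? (q ∣? proj₂ v)) A)
totalWeight-split q qs [] q≢1 cop = z≤n
totalWeight-split q qs (v@(a , b) ∷ A) q≢1 cop
  with ih ← totalWeight-split q qs A q≢1 (λ v∈ → cop (there v∈)) | q ∣? (a * b) | q ∣? a | q ∣? b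
... | _ | yes q∣a | yes q∣b = contradiction (cop (here refl) (q∣a , q∣b)) q≢1
... | yes _ | yes _ | no _ = ≤-trans (+-monoʳ-≤ (weight qs v) ih) (≤-reflexive (solve₁ (weight qs v) (totalWeight qs (filter (λ v → ¬? (q ∣? proj₁ v)) A)) _))
  where
  solve₁ : ∀ a b c → a + (b + c) ≡ b + (a + c)
  solve₁ = solve-∀
... | yes _ | no _ | yes _ = ≤-trans (+-monoʳ-≤ (weight qs v) ih) (≤-reflexive (sym (+-assoc (weight qs v) _ _)))
... | yes _ | no _ | no _ = ≤-trans (+-monoʳ-≤ (weight qs v) ih) (≤-trans (m≤n+m _ (weight qs v)) (≤-reflexive (solve₁ (weight qs v) (totalWeight qs (filter (λ v → ¬? (q ∣? proj₁ v)) A)) _)))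
  where
  solve₁ : ∀ a b c → a + (a + (b + c)) ≡ a + b + (a + c)
  solve₁ = solve-∀
... | no q∤ | yes q∣a | _ = contradiction (∣m⇒∣m*n b q∣a) q∤
... | no q∤ | no _ | yes q∣b = contradiction (∣n⇒∣m*n a q∣b) q∤
... | no _ | no _ | no _ = ≤-trans (+-monoʳ-≤ (2 * weight qs v) ih) (≤-reflexive (solve₁ (weight qs v) (totalWeight qs (filter (λ v → ¬? (q ∣? proj₁ v)) A)) _))
  where
  solve₁ : ∀ a b c → 2 * a + (b + c) ≡ a + b + (a + c)
  solve₁ = solve-∀

-- Assign each prime of qs to the numerators or to the denominators, keeping the heavier half.
separate : ∀ qs A → All Prime qs → (∀ {v} → v ∈ A → Coprime (proj₁ v) (proj₂ v)) →
  ∃[ A′ ] A′ ⊆ A × totalWeight qs A ≤ 2 ^ length qs * length A′ ×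
    (∀ {q v w} → q ∈ qs → v ∈ A′ → w ∈ A′ → q ∣ proj₁ v → ¬ q ∣ proj₂ w)
separate [] A _ _ = A , ⊆-refl , ≤-reflexive (trans (sum-ones A) (sym (+-identityʳ _))) , λ ()
  where
  sum-ones : ∀ A → totalWeight [] A ≡ length A
  sum-ones [] = refl
  sum-ones (v ∷ A) = cong suc (sum-ones A)
separate (q ∷ qs) A (q′ ∷ qs′) cop
  with totalWeight-split q qs A (λ { refl → ¬prime[1] q′ }) cop
     | ≤-total (totalWeight qs (filter (λ v → ¬? (q ∣? proj₁ v)) A)) (totalWeight qs (filter (λ v → ¬? (q ∣? proj₂ v)) A))
... | split | inj₁ le with A′ , sub , big , sep ← separate qs (filter (λ v → ¬? (q ∣? proj₂ v)) A) qs′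
        (λ v∈ → cop (proj₁ (∈-filter⁻ (λ v → ¬? (q ∣? proj₂ v)) v∈))) =
  A′ , ⊆-trans sub (filter-⊆ _ A) ,
  ≤-trans split (≤-trans (+-mono-≤ (≤-trans le big) big) (≤-reflexive (solve₁ (2 ^ length qs) (length A′)))) ,
  λ { (here refl) v∈ w∈ q∣ → proj₂ (∈-filter⁻ (λ v → ¬? (q ∣? proj₂ v)) {xs = A} (Any-resp-⊆ sub w∈))
    ; (there r∈) v∈ w∈ → sep r∈ v∈ w∈ }
  where
  solve₁ : ∀ a b → a * b + a * b ≡ 2 * a * b
  solve₁ = solve-∀
... | split | inj₂ le with A′ , sub , big , sep ← separate qs (filter (λ v → ¬? (q ∣? proj₁ v)) A) qs′
        (λ v∈ → cop (proj₁ (∈-filter⁻ (λ v → ¬? (q ∣? proj₁ v)) v∈))) =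
  A′ , ⊆-trans sub (filter-⊆ _ A) ,
  ≤-trans split (≤-trans (+-mono-≤ big (≤-trans le big)) (≤-reflexive (solve₁ (2 ^ length qs) (length A′)))) ,
  λ { (here refl) v∈ w∈ q∣ → contradiction q∣ (proj₂ (∈-filter⁻ (λ v → ¬? (q ∣? proj₁ v)) {xs = A} (Any-resp-⊆ sub v∈)))
    ; (there r∈) v∈ w∈ → sep r∈ v∈ w∈ }
  where
  solve₁ : ∀ a b → a * b + a * b ≡ 2 * a * b
  solve₁ = solve-∀

Bounded : ℕ → Pair → Set
Bounded L (a , b) = (1 ≤ a × a ≤ L) × (1 ≤ b × b ≤ L)

primesUpTo : ℕ → List ℕ
primesUpTo L = filter prime? (upTo (suc L))

primesUpTo-! : ∀ L → Unique (primesUpTo L)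
primesUpTo-! L = Uniq.filter⁺ prime? (Uniq.upTo⁺ (suc L))

primesUpTo-prime : ∀ L → All Prime (primesUpTo L)
primesUpTo-prime L = All.tabulate λ q∈ → proj₂ (∈-filter⁻ prime? {xs = upTo (suc L)} q∈)

-- Averaging: by `weight-ω` each fraction survives at least one in `t` of all assignments, so the
-- one chosen by `separate` keeps at least |A| / t fractions. The primes up to `L` suffice, because
-- a common prime divides a numerator of size at most `L`.
separatedSubset : ∀ L t A → (∀ {v} → v ∈ A → Bounded L v) → (∀ {v} → v ∈ A → Coprime (proj₁ v) (proj₂ v)) →
  (∀ {v} → v ∈ A → 2 ^ ω (primesUpTo L) (proj₁ v * proj₂ v) ≤ t) →
  ∃[ A′ ] A′ ⊆ A × length A ≤ t * length A′ ×
    (∀ {v w} → v ∈ A′ → w ∈ A′ → Coprime (proj₁ v) (proj₂ w))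
separatedSubset L t A bounded cop ω≤t
  with A′ , sub , big , sep ← separate (primesUpTo L) A (primesUpTo-prime L) cop =
  A′ , sub , A≤ , λ v∈ w∈ → coprime v∈ w∈
  where
  qs = primesUpTo L
  coprime : ∀ {v w} → v ∈ A′ → w ∈ A′ → Coprime (proj₁ v) (proj₂ w)
  coprime {v} {w} v∈ w∈ {i} with commonPrime⊎coprime (proj₁ v) (proj₂ w) (proj₁ (proj₁ (bounded (Any-resp-⊆ sub v∈))))
  ... | inj₁ c = c {i}
  ... | inj₂ (q , q′ , q∣a , q∣b) = contradiction q∣b (sep q∈ v∈ w∈ q∣a)
    where
    q∈ : q ∈ qs
    q∈ = let (1≤a , a≤L) , _ = bounded (Any-resp-⊆ sub v∈) in
      ∈-filter⁺ prime? (∈-upTo⁺ (s≤s (≤-trans (∣⇒≤ {{>-nonZero 1≤a}} q∣a) a≤L))) q′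
  weights : ∀ B → (∀ {v} → v ∈ B → 2 ^ ω qs (proj₁ v * proj₂ v) ≤ t) → length B * 2 ^ length qs ≤ t * totalWeight qs B
  weights [] _ = z≤n
  weights (v ∷ B) small = begin
    2 ^ length qs + length B * 2 ^ length qs ≤⟨ +-mono-≤ one (weights B (λ v∈ → small (there v∈))) ⟩
    t * weight qs v + t * totalWeight qs B ≡⟨ *-distribˡ-+ t (weight qs v) _ ⟨
    t * (weight qs v + totalWeight qs B) ∎
    where
    open ≤-Reasoning
    one : 2 ^ length qs ≤ t * weight qs v
    one = begin
      2 ^ length qs ≡⟨ weight-ω qs v ⟨
      weight qs v * 2 ^ ω qs (proj₁ v * proj₂ v) ≤⟨ *-monoʳ-≤ (weight qs v) (small (here refl)) ⟩
      weight qs v * t ≡⟨ *-comm (weight qs v) t ⟩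
      t * weight qs v ∎
  A≤ : length A ≤ t * length A′
  A≤ = *-cancelʳ-≤ (length A) (t * length A′) (2 ^ length qs) {{>-nonZero (^-positive 2 (length qs) (s≤s z≤n))}} (begin
    length A * 2 ^ length qs ≤⟨ weights A ω≤t ⟩
    t * totalWeight qs A ≤⟨ *-monoʳ-≤ t big ⟩
    t * (2 ^ length qs * length A′) ≡⟨ solve₁ t (2 ^ length qs) (length A′) ⟩
    t * length A′ * 2 ^ length qs ∎)
    where
    open ≤-Reasoning
    solve₁ : ∀ a b c → a * (b * c) ≡ a * c * b
    solve₁ = solve-∀

-- Congruences and primitive lattice points

length-cartesianProduct : ∀ {A B : Set} (xs : List A) (ys : List B) → length (cartesianProduct xs ys) ≡ length xs * length ys
length-cartesianProduct [] ys = refl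
length-cartesianProduct (x ∷ xs) ys = trans (length-++ (map (x ,_) ys))
  (cong₂ _+_ (length-map (x ,_) ys) (length-cartesianProduct xs ys))

module _ {p : ℕ} .{{_ : NonZero p}} where

  %-cong-* : ∀ {a a′ b b′} → a % p ≡ a′ % p → b % p ≡ b′ % p → (a * b) % p ≡ (a′ * b′) % p
  %-cong-* {a} {a′} {b} {b′} eq eq′ = trans (%-distribˡ-* a b p)
    (trans (cong₂ (λ x y → (x * y) % p) eq eq′) (sym (%-distribˡ-* a′ b′ p)))

  ≡%⇒∣ : ∀ x y → x % p ≡ y % p → p ∣ ∣ x - y ∣
  ≡%⇒∣ x y eq = divides ∣ x / p - y / p ∣ (begin
    ∣ x - y ∣ ≡⟨ cong₂ ∣_-_∣ (m≡m%n+[m/n]*n x p) (m≡m%n+[m/n]*n y p) ⟩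
    ∣ x % p + x / p * p - y % p + y / p * p ∣ ≡⟨ cong (λ z → ∣ z + x / p * p - y % p + y / p * p ∣) eq ⟩
    ∣ y % p + x / p * p - y % p + y / p * p ∣ ≡⟨ ∣m+n-m+o∣≡∣n-o∣ (y % p) _ _ ⟩
    ∣ x / p * p - y / p * p ∣ ≡⟨ *-distribʳ-∣-∣ p (x / p) (y / p) ⟨
    ∣ x / p - y / p ∣ * p ∎)
    where open ≡-Reasoning

  ≡%∧≤⇒ : ∀ {x y} → x ≤ y → x % p ≡ y % p → ∃[ k ] y ≡ x + k * p
  ≡%∧≤⇒ {x} {y} x≤y eq with divides k eq′ ← ≡%⇒∣ x y eq =
    k , trans (sym (m+[n∸m]≡n x≤y)) (cong (x +_) (trans (sym (m≤n⇒∣m-n∣≡n∸m x≤y)) eq′))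

  ≡%∧≡/⇒≡ : ∀ {x y} → x % p ≡ y % p → x / p ≡ y / p → x ≡ y
  ≡%∧≡/⇒≡ {x} {y} eq eq′ = trans (m≡m%n+[m/n]*n x p)
    (trans (cong₂ (λ a b → a + b * p) eq eq′) (sym (m≡m%n+[m/n]*n y p)))

  *-cancel-% : Prime p → ∀ {c x y} → ¬ p ∣ c → (c * x) % p ≡ (c * y) % p → x % p ≡ y % p
  *-cancel-% prime-p {c} {x} {y} p∤c eq
    with euclidsLemma c ∣ x - y ∣ prime-p (subst (p ∣_) (sym (*-distribˡ-∣-∣ c x y)) (≡%⇒∣ (c * x) (c * y) eq))
  ... | inj₁ p∣c = contradiction p∣c p∤c
  ... | inj₂ (divides k eq′) with ≤-total x y
  ...   | inj₁ x≤y = sym (trans (cong (_% p) (trans (sym (m+[n∸m]≡n x≤y)) (cong (x +_) (trans (sym (m≤n⇒∣m-n∣≡n∸m x≤y)) eq′)))) ([m+kn]%n≡m%n x k p))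
  ...   | inj₂ y≤x = trans (cong (_% p) (trans (sym (m+[n∸m]≡n y≤x)) (cong (y +_) (trans (sym (m≤n⇒∣n-m∣≡n∸m y≤x)) eq′)))) ([m+kn]%n≡m%n y k p)

  -- Fix v₀ ∈ V with maximal first coordinate a₀.  The determinant a₀ b − a b₀ is a multiple of p,
  -- and it determines (a , b): points with equal determinants differ by a multiple of the primitive v₀.
  primitiveCount-from : ∀ X V → Unique V → (∀ {v} → v ∈ V → Bounded X v) →
    (∀ {v w} → v ∈ V → w ∈ V → (proj₁ v * proj₂ w) % p ≡ (proj₁ w * proj₂ v) % p) →
    ∀ a₀ b₀ → (a₀ , b₀) ∈ V → Coprime a₀ b₀ → (∀ {v} → v ∈ V → proj₁ v ≤ a₀) →
    length V ≤ suc (2 * (X * X) / p)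
  primitiveCount-from X V V! bounded cong-V a₀ b₀ v₀∈ cop max = begin
    length V ≤⟨ length-map-injective _≟_ (λ v → w v / p) V (upTo (suc (2 * (X * X) / p))) V!
      (λ v∈ → ∈-upTo⁺ (s≤s (/-monoˡ-≤ p (w≤ v∈)))) (λ v∈ v′∈ eq → same v∈ v′∈ (≡%∧≡/⇒≡ (trans (w-% v∈) (sym (w-% v′∈))) eq)) ⟩
    length (upTo (suc (2 * (X * X) / p))) ≡⟨ length-upTo _ ⟩
    suc (2 * (X * X) / p) ∎
    where
    open ≤-Reasoning
    -- The determinant shifted by `X * X` to stay in the natural numbers. Its values are at most 2
    -- X² and all congruent to X² modulo `p`, so the quotient by `p` tells them apart.
    w : Pair → ℕ
    w (a , b) = a₀ * b + (X * X ∸ a * b₀)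
    ab₀≤ : ∀ {v} → v ∈ V → proj₁ v * b₀ ≤ X * X
    ab₀≤ v∈ = *-mono-≤ (proj₂ (proj₁ (bounded v∈))) (proj₂ (proj₂ (bounded v₀∈)))
    w≤ : ∀ {v} → v ∈ V → w v ≤ 2 * (X * X)
    w≤ {v} v∈ = +-mono-≤ (*-mono-≤ (proj₂ (proj₁ (bounded v₀∈))) (proj₂ (proj₂ (bounded v∈))))
      (≤-trans (m∸n≤m (X * X) (proj₁ v * b₀)) (≤-reflexive (sym (+-identityʳ _))))
    w-% : ∀ {v} → v ∈ V → w v % p ≡ (X * X) % p
    w-% {v@(a , b)} v∈ with ≤-total (a * b₀) (a₀ * b)
    ... | inj₁ le with k , eq ← ≡%∧≤⇒ le (cong-V v∈ v₀∈) =
      trans (cong (_% p) (trans (cong (_+ (X * X ∸ a * b₀)) eq) (trans (solve₁ (a * b₀) (k * p) _) (cong (_+ k * p) (m+[n∸m]≡n (ab₀≤ v∈))))))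
        ([m+kn]%n≡m%n (X * X) k p)
      where
      solve₁ : ∀ x y z → x + y + z ≡ x + z + y
      solve₁ = solve-∀
    ... | inj₂ le with k , eq ← ≡%∧≤⇒ le (cong-V v₀∈ v∈) =
      trans (sym ([m+kn]%n≡m%n (w v) k p)) (cong (_% p) (trans (solve₁ (a₀ * b) _ (k * p))
        (trans (cong (_+ (X * X ∸ a * b₀)) (sym eq)) (m+[n∸m]≡n (ab₀≤ v∈)))))
      where
      solve₁ : ∀ x y z → x + y + z ≡ x + z + y
      solve₁ = solve-∀
    cross : ∀ {v v′} → v ∈ V → v′ ∈ V → w v ≡ w v′ → a₀ * proj₂ v + proj₁ v′ * b₀ ≡ a₀ * proj₂ v′ + proj₁ v * b₀
    cross {v@(a , b)} {v′@(a′ , b′)} v∈ v′∈ eq = +-cancelʳ-≡ (X * X) _ _ (begin-equality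
      a₀ * b + a′ * b₀ + X * X ≡⟨ cong (a₀ * b + a′ * b₀ +_) (m∸n+n≡m (ab₀≤ v∈)) ⟨
      a₀ * b + a′ * b₀ + (X * X ∸ a * b₀ + a * b₀) ≡⟨ solve₁ (a₀ * b) (a′ * b₀) (X * X ∸ a * b₀) (a * b₀) ⟩
      w v + (a′ * b₀ + a * b₀) ≡⟨ cong (_+ (a′ * b₀ + a * b₀)) eq ⟩
      w v′ + (a′ * b₀ + a * b₀) ≡⟨ solve₂ (a₀ * b′) (a′ * b₀) (X * X ∸ a′ * b₀) (a * b₀) ⟩
      a₀ * b′ + a * b₀ + (X * X ∸ a′ * b₀ + a′ * b₀) ≡⟨ cong (a₀ * b′ + a * b₀ +_) (m∸n+n≡m (ab₀≤ v′∈)) ⟩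
      a₀ * b′ + a * b₀ + X * X ∎)
      where
      solve₁ : ∀ x y z u → x + y + (z + u) ≡ x + z + (y + u)
      solve₁ = solve-∀
      solve₂ : ∀ x y z u → x + z + (y + u) ≡ x + u + (z + y)
      solve₂ = solve-∀
    1≤a₀ = proj₁ (proj₁ (bounded v₀∈))
    -- Equal determinants make `a₀` divide (a′ - a) b₀, hence a′ - a by coprimality. This is
    -- impossible, since 0 < a′ - a < a₀ by maximality of `a₀` and 1 ≤ a.
    ¬lt : ∀ {v v′} → v ∈ V → v′ ∈ V → w v ≡ w v′ → ¬ proj₁ v < proj₁ v′
    ¬lt {v@(a , b)} {v′@(a′ , b′)} v∈ v′∈ eq a<a′ =
      <⇒≱ (<-≤-trans (∸-monoʳ-< {a′} {a} {0} (proj₁ (proj₁ (bounded v∈))) (<⇒≤ a<a′)) (max v′∈))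
        (∣⇒≤ {{>-nonZero (m<n⇒0<n∸m a<a′)}} (coprime-divisor {a₀} {b₀} cop
          (subst (a₀ ∣_) (*-comm (a′ ∸ a) b₀) (∣m+n∣m⇒∣n (subst (a₀ ∣_) (sym sum≡) (m∣m*n b′)) (m∣m*n b)))))
      where
      sum≡ : a₀ * b + (a′ ∸ a) * b₀ ≡ a₀ * b′
      sum≡ = +-cancelʳ-≡ (a * b₀) _ _ (begin-equality
        a₀ * b + (a′ ∸ a) * b₀ + a * b₀ ≡⟨ +-assoc (a₀ * b) _ _ ⟩
        a₀ * b + ((a′ ∸ a) * b₀ + a * b₀) ≡⟨ cong (a₀ * b +_) (*-distribʳ-+ b₀ (a′ ∸ a) a) ⟨
        a₀ * b + (a′ ∸ a + a) * b₀ ≡⟨ cong (λ z → a₀ * b + z * b₀) (m∸n+n≡m (<⇒≤ a<a′)) ⟩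
        a₀ * b + a′ * b₀ ≡⟨ cross v∈ v′∈ eq ⟩
        a₀ * b′ + a * b₀ ∎)
    same : ∀ {v v′} → v ∈ V → v′ ∈ V → w v ≡ w v′ → v ≡ v′
    same {a , b} {a′ , b′} v∈ v′∈ eq with <-cmp a a′
    ... | tri< lt _ _ = contradiction lt (¬lt v∈ v′∈ eq)
    ... | tri> _ _ gt = contradiction gt (¬lt v′∈ v∈ (sym eq))
    ... | tri≈ _ refl _ = cong (a ,_) (*-cancelˡ-≡ b b′ a₀ {{>-nonZero 1≤a₀}} (+-cancelʳ-≡ (a * b₀) _ _ (cross v∈ v′∈ eq)))

  primitiveCount : ∀ X V → Unique V → (∀ {v} → v ∈ V → Bounded X v) →
    (∀ {v} → v ∈ V → Coprime (proj₁ v) (proj₂ v)) →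
    (∀ {v w} → v ∈ V → w ∈ V → (proj₁ v * proj₂ w) % p ≡ (proj₁ w * proj₂ v) % p) →
    length V ≤ suc (2 * (X * X) / p)
  primitiveCount X [] _ _ _ _ = z≤n
  primitiveCount X V@(v₁ ∷ _) V! bounded cop cong-V =
    primitiveCount-from X V V! bounded cong-V (proj₁ v₀) (proj₂ v₀) v₀∈ (cop v₀∈)
      (λ v∈ → All.lookup (Extrema.f[xs]≤f[argmax] {f = proj₁} v₁ V) v∈)
    where
    v₀ = Extrema.argmax proj₁ v₁ V
    v₀∈ : v₀ ∈ V
    v₀∈ with Extrema.argmax-sel proj₁ v₁ V
    ... | inj₁ eq = subst (_∈ V) (sym eq) (here refl)
    ... | inj₂ i = i

-- Products of separated fractions

infixr 7 _⋆_
_⋆_ : Pair → Pair → Pair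
(a , b) ⋆ (x , y) = a * x , b * y

products : List Pair → ℕ → List Pair
products A zero = [ 1 , 1 ]
products A (suc m) = deduplicate _≟ₚ_ (cartesianProductWith _⋆_ A (products A m))

products-! : ∀ A m → Unique (products A m)
products-! A zero = [] ∷ []
products-! A (suc m) = DecUniq.deduplicate-! _≟ₚ_ (cartesianProductWith _⋆_ A (products A m))

∈-products⁻ : ∀ A m {z} → z ∈ products A (suc m) → ∃[ v ] ∃[ w ] v ∈ A × w ∈ products A m × z ≡ v ⋆ w
∈-products⁻ A m z∈ = ∈-cartesianProductWith⁻ _⋆_ A (products A m) (∈-deduplicate⁻ _≟ₚ_ (cartesianProductWith _⋆_ A (products A m)) z∈)

coprime-*ˡ : ∀ {a b c} → Coprime a c → Coprime b c → Coprime (a * b) c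
coprime-*ˡ {a} {b} {c} ac bc {d} (d∣ab , d∣c) =
  bc (coprime-divisor {d} {a} (λ (e∣d , e∣a) → ac (e∣a , ∣-trans e∣d d∣c)) d∣ab , d∣c)

coprime-*ʳ : ∀ {a b c} → Coprime a b → Coprime a c → Coprime a (b * c)
coprime-*ʳ {a} {b} {c} ab ac = Coprimality.sym (coprime-*ˡ {b} {c} {a} (Coprimality.sym ab) (Coprimality.sym ac))

products-bounded : ∀ L A → (∀ {v} → v ∈ A → Bounded L v) → ∀ m {z} → z ∈ products A m → Bounded (L ^ m) z
products-bounded L A bounded zero (here refl) = (≤-refl , ≤-refl) , (≤-refl , ≤-refl)
products-bounded L A bounded (suc m) z∈ with v , w , v∈ , w∈ , refl ← ∈-products⁻ A m z∈
  with (1≤a , a≤) , (1≤b , b≤) ← bounded v∈ | (1≤x , x≤) , (1≤y , y≤) ← products-bounded L A bounded m w∈ =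
  (*-positive 1≤a 1≤x , *-mono-≤ a≤ x≤) , (*-positive 1≤b 1≤y , *-mono-≤ b≤ y≤)

module _ (A : List Pair) (cop : ∀ {v w} → v ∈ A → w ∈ A → Coprime (proj₁ v) (proj₂ w)) where

  products-coprimeʳ : ∀ m {v z} → v ∈ A → z ∈ products A m → Coprime (proj₁ z) (proj₂ v)
  products-coprimeʳ zero {v} v∈ (here refl) {i} = Coprimality.1-coprimeTo (proj₂ v) {i}
  products-coprimeʳ (suc m) {v} v∈ z∈ {i} with u , w , u∈ , w∈ , refl ← ∈-products⁻ A m z∈ =
    coprime-*ˡ {proj₁ u} {proj₁ w} {proj₂ v} (cop u∈ v∈) (products-coprimeʳ m v∈ w∈) {i}

  products-coprimeˡ : ∀ m {v z} → v ∈ A → z ∈ products A m → Coprime (proj₁ v) (proj₂ z)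
  products-coprimeˡ zero {v} v∈ (here refl) {i} = Coprimality.sym (Coprimality.1-coprimeTo (proj₁ v)) {i}
  products-coprimeˡ (suc m) {v} v∈ z∈ {i} with u , w , u∈ , w∈ , refl ← ∈-products⁻ A m z∈ =
    coprime-*ʳ {proj₁ v} {proj₂ u} {proj₂ w} (cop v∈ u∈) (products-coprimeˡ m v∈ w∈) {i}

  -- No numerator of `A` shares a prime with any denominator of `A`, so nothing cancels; the two
  -- preceding lemmas supply the mixed cases.
  products-coprime : ∀ m {z} → z ∈ products A m → Coprime (proj₁ z) (proj₂ z)
  products-coprime zero (here refl) {i} = Coprimality.1-coprimeTo 1 {i}
  products-coprime (suc m) z∈ {i} with u , w , u∈ , w∈ , refl ← ∈-products⁻ A m z∈ =
    coprime-*ˡ {proj₁ u} {proj₁ w} {proj₂ u * proj₂ w}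
      (coprime-*ʳ {proj₁ u} {proj₂ u} {proj₂ w} (cop u∈ u∈) (products-coprimeˡ m u∈ w∈))
      (coprime-*ʳ {proj₁ w} {proj₂ u} {proj₂ w} (products-coprimeʳ m u∈ w∈) (products-coprime m w∈)) {i}

module _ (L t N : ℕ) (A : List Pair) (A! : Unique A) (bounded : ∀ {v} → v ∈ A → Bounded L v)
  (τ≤t : ∀ {n} → 1 ≤ n → n ≤ N → τ n ≤ t) where

  -- If `v ⋆ w` is `(x , y)`, the coordinates of `v` divide `x` and `y`, and `v` determines `w`. A
  -- product therefore arises in at most τ x * τ y ways.
  products-step : ∀ m → L ^ suc m ≤ N → length A * length (products A m) ≤ length (products A (suc m)) * (t * t)
  products-step m L^≤N = begin
    length A * length (products A m) ≡⟨ length-cartesianProduct A (products A m) ⟨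
    length AP ≤⟨ length-cover Q? (t * t) AP (products A (suc m))
      (λ { {v , w} vw∈ → let v∈ , w∈ = ∈-cartesianProduct⁻ A (products A m) vw∈ in
         v ⋆ w , ∈-deduplicate⁺ _≟ₚ_ (∈-cartesianProductWith⁺ _⋆_ v∈ w∈) , refl }) fibre ⟩
    length (products A (suc m)) * (t * t) ∎
    where
    open ≤-Reasoning
    AP = cartesianProduct A (products A m)
    Q? : ∀ vw z → Dec (proj₁ vw ⋆ proj₂ vw ≡ z)
    Q? vw z = (proj₁ vw ⋆ proj₂ vw) ≟ₚ z
    fibre : ∀ {z} → z ∈ products A (suc m) → length (filter (λ vw → Q? vw z) AP) ≤ t * t
    fibre {z@(x , y)} z∈ with (1≤x , x≤) , (1≤y , y≤) ← products-bounded L A bounded (suc m) z∈ = begin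
      length F ≤⟨ length-map-injective _≟ₚ_ proj₁ F D (Uniq.filter⁺ (λ vw → Q? vw z) (Uniq.cartesianProduct⁺ A! (products-! A m))) into inj ⟩
      length D ≡⟨ length-cartesianProduct (divisors x) (divisors y) ⟩
      τ x * τ y ≤⟨ *-mono-≤ (τ≤t 1≤x (≤-trans x≤ L^≤N)) (τ≤t 1≤y (≤-trans y≤ L^≤N)) ⟩
      t * t ∎
      where
      F = filter (λ vw → Q? vw z) AP
      D = cartesianProduct (divisors x) (divisors y)
      into : ∀ {vw} → vw ∈ F → proj₁ vw ∈ D
      into {(a , b) , (x′ , y′)} vw∈ with _ , refl ← ∈-filter⁻ (λ vw → Q? vw z) {xs = AP} vw∈ =
        ∈-cartesianProduct⁺ (∈-divisors⁺ 1≤x (m∣m*n x′)) (∈-divisors⁺ 1≤y (m∣m*n y′))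
      inj : ∀ {vw vw′} → vw ∈ F → vw′ ∈ F → proj₁ vw ≡ proj₁ vw′ → vw ≡ vw′
      inj {(a , b) , (x′ , y′)} {.(a , b) , (x″ , y″)} vw∈ vw′∈ refl
        with ∈AP , eq ← ∈-filter⁻ (λ vw → Q? vw z) {xs = AP} vw∈ | _ , eq′ ← ∈-filter⁻ (λ vw → Q? vw z) {xs = AP} vw′∈
        with (1≤a , _) , (1≤b , _) ← bounded (proj₁ (∈-cartesianProduct⁻ A (products A m) ∈AP)) =
        cong₂ (λ s r → (a , b) , (s , r))
          (*-cancelˡ-≡ x′ x″ a {{>-nonZero 1≤a}} (cong proj₁ (trans eq (sym eq′))))
          (*-cancelˡ-≡ y′ y″ b {{>-nonZero 1≤b}} (cong proj₂ (trans eq (sym eq′))))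

  products-growth : 1 ≤ L → ∀ m → L ^ m ≤ N → length A ^ m ≤ (t * t) ^ m * length (products A m)
  products-growth 1≤L zero _ = ≤-refl
  products-growth 1≤L (suc m) L^≤N = begin
    length A * length A ^ m ≤⟨ *-monoʳ-≤ (length A) (products-growth 1≤L m (≤-trans (^-monoʳ-≤ L {{>-nonZero 1≤L}} (n≤1+n m)) L^≤N)) ⟩
    length A * ((t * t) ^ m * length (products A m)) ≡⟨ solve₁ (length A) ((t * t) ^ m) (length (products A m)) ⟩
    (t * t) ^ m * (length A * length (products A m)) ≤⟨ *-monoʳ-≤ ((t * t) ^ m) (products-step m L^≤N) ⟩
    (t * t) ^ m * (length (products A (suc m)) * (t * t)) ≡⟨ solve₂ ((t * t) ^ m) (length (products A (suc m))) (t * t) ⟩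
    (t * t) ^ suc m * length (products A (suc m)) ∎
    where
    open ≤-Reasoning
    solve₁ : ∀ a b c → a * (b * c) ≡ b * (a * c)
    solve₁ = solve-∀
    solve₂ : ∀ a b c → a * (b * c) ≡ c * a * b
    solve₂ = solve-∀

range : ℕ → List ℕ
range L = map suc (upTo L)

∈-range⁺ : ∀ {n L} → 1 ≤ n → n ≤ L → n ∈ range L
∈-range⁺ {suc n} _ n<L = ∈-map⁺ suc (∈-upTo⁺ n<L)

∈-range⁻ : ∀ {n L} → n ∈ range L → 1 ≤ n × n ≤ L
∈-range⁻ n∈ with _ , m∈ , refl ← ∈-map⁻ suc n∈ = s≤s z≤n , ∈-upTo⁻ m∈

length-range : ∀ L → length (range L) ≡ L
length-range L = trans (length-map suc (upTo L)) (length-upTo L)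

-- Fractions whose residues lie in a set of small doubling

module Residues (p : ℕ) .{{_ : NonZero p}} where

  infixl 7 _∙_
  _∙_ : Fin p → Fin p → Fin p
  a ∙ b = fromℕ< (m%n<n (toℕ a * toℕ b) p)

  toℕ-∙ : ∀ a b → toℕ (a ∙ b) ≡ (toℕ a * toℕ b) % p
  toℕ-∙ a b = toℕ-fromℕ< (m%n<n (toℕ a * toℕ b) p)

  one : Fin p
  one = fromℕ< (m%n<n 1 p)

  toℕ-% : ∀ (a : Fin p) → toℕ a % p ≡ toℕ a
  toℕ-% a = m<n⇒m%n≡m (toℕ<n a)

  toℕ-∙-% : ∀ a b → toℕ (a ∙ b) % p ≡ (toℕ a * toℕ b) % p
  toℕ-∙-% a b = trans (toℕ-% (a ∙ b)) (toℕ-∙ a b)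

  ∙-comm : ∀ a b → a ∙ b ≡ b ∙ a
  ∙-comm a b = toℕ-injective (trans (toℕ-∙ a b) (trans (cong (_% p) (*-comm (toℕ a) (toℕ b))) (sym (toℕ-∙ b a))))

  ∙-assoc : ∀ a b c → (a ∙ b) ∙ c ≡ a ∙ (b ∙ c)
  ∙-assoc a b c = toℕ-injective (begin
    toℕ ((a ∙ b) ∙ c) ≡⟨ toℕ-∙ (a ∙ b) c ⟩
    (toℕ (a ∙ b) * toℕ c) % p ≡⟨ %-cong-* {b = toℕ c} (toℕ-∙-% a b) refl ⟩
    (toℕ a * toℕ b * toℕ c) % p ≡⟨ cong (_% p) (*-assoc (toℕ a) (toℕ b) (toℕ c)) ⟩
    (toℕ a * (toℕ b * toℕ c)) % p ≡⟨ %-cong-* {a = toℕ a} refl (toℕ-∙-% b c) ⟨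
    (toℕ a * toℕ (b ∙ c)) % p ≡⟨ toℕ-∙ a (b ∙ c) ⟨
    toℕ (a ∙ (b ∙ c)) ∎)
    where open ≡-Reasoning

  toℕ-one-% : toℕ one % p ≡ 1 % p
  toℕ-one-% = trans (toℕ-% one) (toℕ-fromℕ< (m%n<n 1 p))

  ∙-identityˡ : ∀ a → one ∙ a ≡ a
  ∙-identityˡ a = toℕ-injective (begin
    toℕ (one ∙ a) ≡⟨ toℕ-∙ one a ⟩
    (toℕ one * toℕ a) % p ≡⟨ %-cong-* {b = toℕ a} toℕ-one-% refl ⟩
    (1 * toℕ a) % p ≡⟨ cong (_% p) (*-identityˡ (toℕ a)) ⟩
    toℕ a % p ≡⟨ toℕ-% a ⟩
    toℕ a ∎)
    where open ≡-Reasoning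

  open ProductSets Fin._≟_ _∙_ one ∙-assoc ∙-comm ∙-identityˡ public
  open Card (Fin._≟_ {p}) public using (card)

  p∤ : ∀ {n} → 1 ≤ n → n < p → ¬ p ∣ n
  p∤ 1≤n n<p p∣n = <⇒≱ n<p (∣⇒≤ {{>-nonZero 1≤n}} p∣n)

  nonzero-cancellable : Prime p → ∀ {c} → ¬ toℕ c ≡ 0 → Cancellable c
  nonzero-cancellable prime-p {c} c≢0 {x} {y} eq = toℕ-injective (begin
    toℕ x ≡⟨ toℕ-% x ⟨
    toℕ x % p ≡⟨ *-cancel-% prime-p (p∤ (n≢0⇒n>0 c≢0) (toℕ<n c)) (trans (sym (toℕ-∙ c x)) (trans (cong toℕ eq) (toℕ-∙ c y))) ⟩
    toℕ y % p ≡⟨ toℕ-% y ⟩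
    toℕ y ∎)
    where open ≡-Reasoning

  -- The congruence a / b ≡ u with the denominator cleared, which avoids inverses modulo `p`.
  Res : Pair → Fin p → Set
  Res v u = proj₁ v % p ≡ (proj₂ v * toℕ u) % p

  Res? : ∀ v u → Dec (Res v u)
  Res? v u = proj₁ v % p ≟ (proj₂ v * toℕ u) % p

  Res-⋆ : ∀ {v w u r} → Res v u → Res w r → Res (v ⋆ w) (u ∙ r)
  Res-⋆ {a , b} {x , y} {u} {r} vu wr = begin
    (a * x) % p ≡⟨ %-cong-* {a = a} {b * toℕ u} {x} {y * toℕ r} vu wr ⟩
    (b * toℕ u * (y * toℕ r)) % p ≡⟨ cong (_% p) (solve₁ b (toℕ u) y (toℕ r)) ⟩
    (b * y * (toℕ u * toℕ r)) % p ≡⟨ %-cong-* {a = b * y} refl (toℕ-∙-% u r) ⟨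
    (b * y * toℕ (u ∙ r)) % p ∎
    where
    open ≡-Reasoning
    solve₁ : ∀ a b c d → a * b * (c * d) ≡ a * c * (b * d)
    solve₁ = solve-∀

  Res-cross : ∀ {v w u} → Res v u → Res w u → (proj₁ v * proj₂ w) % p ≡ (proj₁ w * proj₂ v) % p
  Res-cross {a , b} {x , y} {u} vu wu = begin
    (a * y) % p ≡⟨ %-cong-* {b = y} vu refl ⟩
    (b * toℕ u * y) % p ≡⟨ cong (_% p) (solve₁ b (toℕ u) y) ⟩
    (y * toℕ u * b) % p ≡⟨ %-cong-* {b = b} wu refl ⟨
    (x * b) % p ∎
    where
    open ≡-Reasoning
    solve₁ : ∀ a b c → a * b * c ≡ c * b * a
    solve₁ = solve-∀

  products-residue : ∀ A U → (∀ {v} → v ∈ A → ∃[ u ] u ∈ U × Res v u) →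
    ∀ m {z} → z ∈ products A m → ∃[ u ] u ∈ power U m × Res z u
  products-residue A U res zero (here refl) = one , here refl , sym (trans (cong (_% p) (+-identityʳ (toℕ one))) toℕ-one-%)
  products-residue A U res (suc m) z∈ with v , w , v∈ , w∈ , refl ← ∈-products⁻ A m z∈
    with u , u∈ , vu ← res v∈ | r , r∈ , wr ← products-residue A U res m w∈ =
    u ∙ r , ⊗⁺ u∈ r∈ , Res-⋆ {v} {w} vu wr

  primitiveCount-residues : ∀ X V R → Unique V → (∀ {v} → v ∈ V → Bounded X v) →
    (∀ {v} → v ∈ V → Coprime (proj₁ v) (proj₂ v)) → (∀ {v} → v ∈ V → ∃[ u ] u ∈ R × Res v u) →
    length V ≤ card R * suc (2 * (X * X) / p)
  primitiveCount-residues X V R V! bounded cop res = length-cover Res? (suc (2 * (X * X) / p)) V (deduplicate Fin._≟_ R)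
    (λ v∈ → let u , u∈ , vu = res v∈ in u , ∈-deduplicate⁺ Fin._≟_ u∈ , vu)
    λ {u} _ → let mem = λ {v} (v∈ : v ∈ filter (λ v → Res? v u) V) → ∈-filter⁻ (λ v → Res? v u) {xs = V} v∈ in
      primitiveCount X _ (Uniq.filter⁺ (λ v → Res? v u) V!) (λ v∈ → bounded (proj₁ (mem v∈)))
        (λ v∈ → cop (proj₁ (mem v∈))) (λ v∈ w∈ → Res-cross {u = u} (proj₂ (mem v∈)) (proj₂ (mem w∈)))

  record SmallDoubling (K : ℕ) (U : List (Fin p)) : Set where
    field
      unique      : Unique U
      nonzero     : ∀ {u} → u ∈ U → ¬ toℕ u ≡ 0
      doubling    : card (U ⊗ U) < K * length U

  -- Of the three factors `t` per fraction, one pays for separating the primes and two for the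
  -- factorisations of numerator and denominator. `N` has to dominate both the products a b, where ω
  -- is taken, and the coordinates of m-fold products, where τ is taken.
  primitivePowerBound : Prime p → ∀ {K U} → SmallDoubling K U → ∀ L t N m → 1 ≤ L → L * L ≤ N → L ^ m ≤ N →
    (∀ {n} → 1 ≤ n → n ≤ N → τ n ≤ t) →
    (∀ {n qs} → 1 ≤ n → n ≤ N → Unique qs → All Prime qs → 2 ^ ω qs n ≤ t) →
    ∀ A → Unique A → (∀ {v} → v ∈ A → Bounded L v) → (∀ {v} → v ∈ A → Coprime (proj₁ v) (proj₂ v)) →
    (∀ {v} → v ∈ A → ∃[ u ] u ∈ U × Res v u) →
    length A ^ m ≤ (t * (t * t)) ^ m * (K ^ m * length U * suc (2 * (L ^ m * L ^ m) / p))
  primitivePowerBound prime-p {K} {U} sd L t N m 1≤L LL≤N L^m≤N τ≤t ω≤t A A! bounded cop res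
    with A′ , sub , A≤ , cop′ ← separatedSubset L t A bounded cop
      (λ v∈ → let (1≤a , a≤) , (1≤b , b≤) = bounded v∈ in
        ω≤t (*-positive 1≤a 1≤b) (≤-trans (*-mono-≤ a≤ b≤) LL≤N) (primesUpTo-! L) (primesUpTo-prime L)) = begin
    length A ^ m ≤⟨ ^-monoˡ-≤ m A≤ ⟩
    (t * length A′) ^ m ≡⟨ ^-distribʳ-* m t (length A′) ⟩
    t ^ m * length A′ ^ m ≤⟨ *-monoʳ-≤ (t ^ m) (products-growth L t N A′ (Unique-resp-⊆ sub A!) bounded′ τ≤t 1≤L m L^m≤N) ⟩
    t ^ m * ((t * t) ^ m * length (products A′ m)) ≡⟨ *-assoc (t ^ m) _ _ ⟨
    t ^ m * (t * t) ^ m * length (products A′ m) ≡⟨ cong (_* length (products A′ m)) (^-distribʳ-* m t (t * t)) ⟨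
    (t * (t * t)) ^ m * length (products A′ m) ≤⟨ *-monoʳ-≤ ((t * (t * t)) ^ m)
      (primitiveCount-residues (L ^ m) (products A′ m) (power U m) (products-! A′ m)
        (products-bounded L A′ bounded′ m) (λ z∈ → products-coprime A′ cop′ m z∈)
        (products-residue A′ U (λ v∈ → res (Any-resp-⊆ sub v∈)) m)) ⟩
    (t * (t * t)) ^ m * (card (power U m) * suc (2 * (L ^ m * L ^ m) / p))
      ≤⟨ *-monoʳ-≤ ((t * (t * t)) ^ m) (*-monoˡ-≤ (suc (2 * (L ^ m * L ^ m) / p))
        (plünnecke K U unique (λ u∈ → nonzero-cancellable prime-p (nonzero u∈)) doubling m)) ⟩
    (t * (t * t)) ^ m * (K ^ m * length U * suc (2 * (L ^ m * L ^ m) / p)) ∎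
    where
    open ≤-Reasoning
    open SmallDoubling sd
    bounded′ : ∀ {v} → v ∈ A′ → Bounded L v
    bounded′ v∈ = bounded (Any-resp-⊆ sub v∈)

  Primitive : List (Fin p) → Pair → Set
  Primitive U v = Coprime (proj₁ v) (proj₂ v) × Any.Any (Res v) U

  primitive? : ∀ U v → Dec (Primitive U v)
  primitive? U v = coprime? (proj₁ v) (proj₂ v) ×-dec Any.any? (Res? v) U

  primitives : List (Fin p) → ℕ → List Pair
  primitives U L = filter (primitive? U) (cartesianProduct (range L) (range L))

  primitives-! : ∀ U L → Unique (primitives U L)
  primitives-! U L = Uniq.filter⁺ (primitive? U) (Uniq.cartesianProduct⁺ range-! range-!)
    where
    range-! : Unique (range L)
    range-! = Uniq.map⁺ suc-injective (Uniq.upTo⁺ L)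

  ∈-primitives⁺ : ∀ {U L v} → Bounded L v → Primitive U v → v ∈ primitives U L
  ∈-primitives⁺ {U} ((1≤a , a≤) , (1≤b , b≤)) pr =
    ∈-filter⁺ (primitive? U) (∈-cartesianProduct⁺ (∈-range⁺ 1≤a a≤) (∈-range⁺ 1≤b b≤)) pr

  ∈-primitives⁻ : ∀ {U L v} → v ∈ primitives U L → Bounded L v × Primitive U v
  ∈-primitives⁻ {U} {L} v∈ with v∈L , pr ← ∈-filter⁻ (primitive? U) {xs = cartesianProduct (range L) (range L)} v∈
    with a∈ , b∈ ← ∈-cartesianProduct⁻ (range L) (range L) v∈L = (∈-range⁻ a∈ , ∈-range⁻ b∈) , pr

  length-primitives : ∀ U L → length (primitives U L) ≤ L * L
  length-primitives U L = ≤-trans (length-filter (primitive? U) (cartesianProduct (range L) (range L)))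
    (≤-reflexive (trans (length-cartesianProduct (range L) (range L)) (cong₂ _*_ (length-range L) (length-range L))))

  -- The power inequality for S(L) multiplied by `p`, with one loss factor `T` for all `U`, `L` and
  -- `m` at once.
  PowerBounds : ℕ → ℕ → ℕ → Set
  PowerBounds K k T = ∀ U → SmallDoubling K U → ∀ L m → 1 ≤ L → L ≤ p → m ≤ k →
    length (primitives U L) ^ m * p ≤ T * length U * (p + 2 * (L ^ m * L ^ m))

-- T absorbs the divisor-function losses and the doubling constants.
primitivePowerBounds : ∀ K k → 1 ≤ K → 1 ≤ k → ∃[ C ] ((p : ℕ) → .{{_ : NonZero p}} → Prime p →
  ∃[ T ] 1 ≤ T × T ^ k ≤ C * p × Residues.PowerBounds p K k T)
primitivePowerBounds K k 1≤K 1≤k with C , loss ← divisorLoss (3 * k * k * (2 + k)) (*-positive (*-positive (*-positive (s≤s (z≤n {2})) 1≤k) 1≤k) (s≤s z≤n)) =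
  C * K ^ (k * k) , bounds
  where
  open ≤-Reasoning
  bounds : (p : ℕ) → .{{_ : NonZero p}} → Prime p →
    ∃[ T ] 1 ≤ T × T ^ k ≤ C * K ^ (k * k) * p × Residues.PowerBounds p K k T
  bounds p prime-p with 1≤p ← <⇒≤ (prime>1 prime-p)
    -- The number p^(2+k) dominates `L * L` and `L ^ m` for L ≤ p and m ≤ k. Since T^k contains
    -- t^(3kk), the exponent 3kk(2+k) given to `divisorLoss` makes (T^k)^(2+k) at most a constant
    -- times p^(2+k).
    with t , 1≤t , t^≤ , τ≤t , ω≤t ← loss (p ^ (2 + k)) (^-positive p (2 + k) 1≤p) =
    T , *-positive (^-positive t³ k 1≤t³) (^-positive K k 1≤K) ,
    ^-cancelˡ-≤ (2 + k) (s≤s z≤n) (begin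
      (T ^ k) ^ (2 + k) ≡⟨ T-power ⟩
      t ^ E * (K ^ (k * k)) ^ (2 + k) ≤⟨ *-monoˡ-≤ _ t^≤ ⟩
      C * p ^ (2 + k) * (K ^ (k * k)) ^ (2 + k) ≤⟨ *-monoˡ-≤ _ (*-monoˡ-≤ _ (n≤n^ (2 + k) C (s≤s z≤n))) ⟩
      C ^ (2 + k) * p ^ (2 + k) * (K ^ (k * k)) ^ (2 + k) ≡⟨ solve₁ (C ^ (2 + k)) (p ^ (2 + k)) ((K ^ (k * k)) ^ (2 + k)) ⟩
      C ^ (2 + k) * (K ^ (k * k)) ^ (2 + k) * p ^ (2 + k) ≡⟨ cong (_* p ^ (2 + k)) (^-distribʳ-* (2 + k) C (K ^ (k * k))) ⟨
      (C * K ^ (k * k)) ^ (2 + k) * p ^ (2 + k) ≡⟨ ^-distribʳ-* (2 + k) (C * K ^ (k * k)) p ⟨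
      (C * K ^ (k * k) * p) ^ (2 + k) ∎) ,
    powers
    where
    E = 3 * k * k * (2 + k)
    t³ = t * (t * t)
    1≤t³ = *-positive 1≤t (*-positive 1≤t 1≤t)
    T = t³ ^ k * K ^ k
    solve₁ : ∀ a b c → a * b * c ≡ a * c * b
    solve₁ = solve-∀
    t³≡ : t³ ≡ t ^ 3
    t³≡ = cong (t *_) (cong (t *_) (sym (*-identityʳ t)))
    T-power : (T ^ k) ^ (2 + k) ≡ t ^ E * (K ^ (k * k)) ^ (2 + k)
    T-power = begin-equality
      (T ^ k) ^ (2 + k) ≡⟨ cong (_^ (2 + k)) (^-distribʳ-* k (t³ ^ k) (K ^ k)) ⟩
      ((t³ ^ k) ^ k * (K ^ k) ^ k) ^ (2 + k) ≡⟨ ^-distribʳ-* (2 + k) ((t³ ^ k) ^ k) ((K ^ k) ^ k) ⟩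
      ((t³ ^ k) ^ k) ^ (2 + k) * ((K ^ k) ^ k) ^ (2 + k) ≡⟨ cong₂ _*_
        (trans (cong (λ s → ((s ^ k) ^ k) ^ (2 + k)) t³≡) (trans (cong (λ s → (s ^ k) ^ (2 + k)) (^-*-assoc t 3 k))
          (trans (cong (_^ (2 + k)) (^-*-assoc t (3 * k) k)) (^-*-assoc t (3 * k * k) (2 + k)))))
        (cong (_^ (2 + k)) (^-*-assoc K k k)) ⟩
      t ^ E * (K ^ (k * k)) ^ (2 + k) ∎
    powers : Residues.PowerBounds p K k T
    powers U sd L m 1≤L L≤p m≤k = begin
      length (Residues.primitives p U L) ^ m * p ≤⟨ *-monoˡ-≤ p (Residues.primitivePowerBound p prime-p sd L t (p ^ (2 + k)) m 1≤L
        (≤-trans (*-mono-≤ L≤p L≤p) (≤-trans (≤-reflexive (cong (p *_) (sym (*-identityʳ p)))) (^-monoʳ-≤ p {2} {2 + k} (s≤s (s≤s z≤n)))))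
        (≤-trans (^-monoˡ-≤ m L≤p) (^-monoʳ-≤ p (≤-trans m≤k (m≤n+m k 2)))) τ≤t ω≤t
        (Residues.primitives p U L) (Residues.primitives-! p U L) (λ v∈ → proj₁ (Residues.∈-primitives⁻ p {U} {L} v∈))
        (λ v∈ → proj₁ (proj₂ (Residues.∈-primitives⁻ p {U} {L} v∈)))
        (λ v∈ → find (proj₂ (proj₂ (Residues.∈-primitives⁻ p {U} {L} v∈))))) ⟩
      t³ ^ m * (K ^ m * u * suc (Y / p)) * p ≤⟨ *-monoˡ-≤ p (*-mono-≤ (^-monoʳ-≤ t³ {{>-nonZero 1≤t³}} m≤k)
        (*-monoˡ-≤ (suc (Y / p)) (*-monoˡ-≤ u (^-monoʳ-≤ K {{>-nonZero 1≤K}} m≤k)))) ⟩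
      t³ ^ k * (K ^ k * u * suc (Y / p)) * p ≡⟨ solve₂ (t³ ^ k) (K ^ k) u (suc (Y / p)) p ⟩
      T * u * (p + Y / p * p) ≤⟨ *-monoʳ-≤ (T * u) (+-monoʳ-≤ p (m/n*n≤m Y p)) ⟩
      T * u * (p + Y) ∎
      where
      u = length U
      Y = 2 * (L ^ m * L ^ m)
      solve₂ : ∀ a b u s p → a * (b * u * s) * p ≡ a * b * u * (s * p)
      solve₂ = solve-∀

-- From solutions to primitive fractions

open import Data.Fin.Subset using (∣_∣)

elements : ∀ {n} → Subset n → List (Fin n)
elements []ᵛ = []
elements (inside ∷ᵛ S) = zero ∷ map suc (elements S)
elements (outside ∷ᵛ S) = map suc (elements S)

length-elements : ∀ {n} (S : Subset n) → length (elements S) ≡ ∣ S ∣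
length-elements []ᵛ = refl
length-elements (inside ∷ᵛ S) = cong suc (trans (length-map suc (elements S)) (length-elements S))
length-elements (outside ∷ᵛ S) = trans (length-map suc (elements S)) (length-elements S)

∈-elements⁺ : ∀ {n} {S : Subset n} {x} → x ∈ˢ S → x ∈ elements S
∈-elements⁺ {S = inside ∷ᵛ S} hereᵛ = here refl
∈-elements⁺ {S = inside ∷ᵛ S} (thereᵛ x∈) = there (∈-map⁺ suc (∈-elements⁺ x∈))
∈-elements⁺ {S = outside ∷ᵛ S} (thereᵛ x∈) = ∈-map⁺ suc (∈-elements⁺ x∈)

∈-elements⁻ : ∀ {n} {S : Subset n} {x} → x ∈ elements S → x ∈ˢ S
∈-elements⁻ {S = inside ∷ᵛ S} (here refl) = hereᵛ
∈-elements⁻ {S = inside ∷ᵛ S} (there x∈) with _ , y∈ , refl ← ∈-map⁻ suc x∈ = thereᵛ (∈-elements⁻ y∈)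
∈-elements⁻ {S = outside ∷ᵛ S} x∈ with _ , y∈ , refl ← ∈-map⁻ suc x∈ = thereᵛ (∈-elements⁻ y∈)

elements-! : ∀ {n} (S : Subset n) → Unique (elements S)
elements-! []ᵛ = []
elements-! (inside ∷ᵛ S) = Allₚ.map⁺ (All.universal (λ _ ()) (elements S)) ∷ Uniq.map⁺ Fin.suc-injective (elements-! S)
elements-! (outside ∷ᵛ S) = Uniq.map⁺ Fin.suc-injective (elements-! S)

length-filter-map : ∀ {A B : Set} {P : B → Set} (P? : Decidable P) (h : A → B) xs →
  length (filter P? (map h xs)) ≡ length (filter (λ x → P? (h x)) xs)
length-filter-map P? h [] = refl
length-filter-map P? h (x ∷ xs) with does (P? (h x))
... | true  = cong suc (length-filter-map P? h xs)
... | false = length-filter-map P? h xs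

vsum-indicator : ∀ {A : Set} {P : A → Set} (P? : Decidable P) n (g : Fin n → A) →
  vsum (vtabulate λ i → if does (P? (g i)) then 1 else 0) ≡ length (filter P? (tabulate g))
vsum-indicator P? zero g = refl
vsum-indicator P? (suc n) g with does (P? (g zero))
... | true  = cong suc (vsum-indicator P? n (g ∘ suc))
... | false = vsum-indicator P? n (g ∘ suc)

vsum-cartesianProduct : ∀ {A B : Set} {P : A × B → Set} (P? : Decidable P) n (g : Fin n → A) (f : Fin n → ℕ) ys →
  (∀ i → f i ≡ length (filter (λ y → P? (g i , y)) ys)) →
  vsum (vtabulate f) ≡ length (filter P? (cartesianProduct (tabulate g) ys))
vsum-cartesianProduct P? zero g f ys eq = refl
vsum-cartesianProduct P? (suc n) g f ys eq = sym (begin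
  length (filter P? (map (g zero ,_) ys ++ rest)) ≡⟨ cong length (filter-++ P? (map (g zero ,_) ys) rest) ⟩
  length (filter P? (map (g zero ,_) ys) ++ filter P? rest) ≡⟨ length-++ (filter P? (map (g zero ,_) ys)) ⟩
  length (filter P? (map (g zero ,_) ys)) + length (filter P? rest)
    ≡⟨ cong₂ _+_ (trans (length-filter-map P? (g zero ,_) ys) (sym (eq zero))) (sym (vsum-cartesianProduct P? n (g ∘ suc) (f ∘ suc) ys (λ i → eq (suc i)))) ⟩
  f zero + vsum (vtabulate (f ∘ suc)) ∎)
  where
  open ≡-Reasoning
  rest = cartesianProduct (tabulate (g ∘ suc)) ys

-- Dyadic summation

sumTo : (ℕ → ℕ) → ℕ → ℕ
sumTo s zero = 0
sumTo s (suc n) = s (suc n) + sumTo s n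

harmonic-block : ∀ s M → (∀ d → 1 ≤ d → d * s d ≤ M) → ∀ h b e → h ≤ suc b →
  h * sumTo s (e + b) ≤ e * M + h * sumTo s b
harmonic-block s M le h b zero h≤ = ≤-refl
harmonic-block s M le h b (suc e) h≤ = begin
  h * (s (suc (e + b)) + sumTo s (e + b)) ≡⟨ *-distribˡ-+ h (s (suc (e + b))) _ ⟩
  h * s (suc (e + b)) + h * sumTo s (e + b) ≤⟨ +-mono-≤
    (≤-trans (*-monoˡ-≤ (s (suc (e + b))) (≤-trans h≤ (s≤s (m≤n+m b e)))) (le (suc (e + b)) (s≤s z≤n)))
    (harmonic-block s M le h b e h≤) ⟩
  M + (e * M + h * sumTo s b) ≡⟨ +-assoc M (e * M) _ ⟨
  M + e * M + h * sumTo s b ∎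
  where open ≤-Reasoning

-- The block from 2^i to 2^(i+1) - 1 has 2^i terms, each at most M / 2^i, so the sum costs one `M`
-- per binary digit. The block starts at `h`, so the shorter sum ends at `b` = h - 1.
harmonic : ∀ s M → (∀ d → 1 ≤ d → d * s d ≤ M) → ∀ j n → n < 2 ^ j → sumTo s n ≤ j * M
harmonic s M le zero zero _ = z≤n
harmonic s M le zero (suc n) (s≤s ())
harmonic s M le (suc j) n n<2^ with n <? 2 ^ j
... | yes n< = ≤-trans (harmonic s M le j n n<) (m≤n+m (j * M) M)
... | no n≮ = *-cancelˡ-≤ h {{>-nonZero 1≤h}} (begin
  h * sumTo s n ≡⟨ cong (λ z → h * sumTo s z) (m∸n+n≡m b≤n) ⟨
  h * sumTo s (e + b) ≤⟨ harmonic-block s M le h b e (≤-reflexive (sym suc-b≡h)) ⟩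
  e * M + h * sumTo s b ≤⟨ +-mono-≤ (*-monoˡ-≤ M e≤h) (*-monoʳ-≤ h (harmonic s M le j b (≤-reflexive suc-b≡h))) ⟩
  h * M + h * (j * M) ≡⟨ *-distribˡ-+ h M (j * M) ⟨
  h * (M + j * M) ∎)
  where
  open ≤-Reasoning
  h = 2 ^ j
  1≤h = ^-positive 2 j (s≤s z≤n)
  b = h ∸ 1
  e = n ∸ b
  suc-b≡h : suc b ≡ h
  suc-b≡h = m+[n∸m]≡n 1≤h
  b≤n : b ≤ n
  b≤n = ≤-trans (m∸n≤m h 1) (≮⇒≥ n≮)
  e≤h : e ≤ h
  e≤h = m≤n+o⇒m∸n≤o n b (s≤s⁻¹ (≤-trans n<2^ (≤-reflexive (trans (cong (h +_) (+-identityʳ h)) (cong (_+ h) (sym suc-b≡h))))))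

binaryLength : ∀ H → 1 ≤ H → ∃[ j ] H < 2 ^ j × 2 ^ j ≤ 2 * H
binaryLength (suc zero) _ = 1 , ≤-refl , ≤-refl
binaryLength (suc H@(suc _)) _ with j , H< , 2^≤ ← binaryLength H (s≤s z≤n) | suc H <? 2 ^ j
... | yes lt = j , lt , ≤-trans 2^≤ (*-monoʳ-≤ 2 (n≤1+n H))
... | no ¬lt = suc j , <-≤-trans (s≤s H<) (+-mono-≤ (^-positive 2 j (s≤s z≤n)) (≤-reflexive (sym (+-identityʳ (2 ^ j))))) , *-monoʳ-≤ 2 (≮⇒≥ ¬lt)

module Solutions (p : ℕ) .{{_ : NonZero p}} (U : Subset p) where
  open Residues p

  Us : List (Fin p)
  Us = elements U

  smallDoubling : ∀ K → InUnits p U → ∣ prodSet p U ∣ < K * ∣ U ∣ → SmallDoubling K Us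
  smallDoubling K units small = record
    { unique = elements-! U
    ; nonzero = λ u∈ → units _ (∈-elements⁻ u∈)
    ; doubling = ≤-<-trans (subst (card (Us ⊗ Us) ≤_) (length-elements (prodSet p U)) (Card.card≤length Fin._≟_ {Us ⊗ Us} into))
        (subst (λ z → ∣ prodSet p U ∣ < K * z) (sym (length-elements U)) small)
    }
    where
    into : ∀ {z} → z ∈ Us ⊗ Us → z ∈ elements (prodSet p U)
    into {z} z∈ with a , b , a∈ , b∈ , eq ← ⊗⁻ Us Us z∈ = ∈-elements⁺ (lookup⇒[]= z (prodSet p U)
      (trans (lookup∘tabulate _ z) (cong (if_then inside else outside)
        (dec-true (inProd? p U z) (a , b , (∈-elements⁻ a∈ , ∈-elements⁻ b∈) , sym (trans (cong toℕ eq) (toℕ-∙ a b)))))))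

  module _ (H : ℕ) where

    Triple : Set
    Triple = Fin H × Fin H × Fin p

    IsSolution : Triple → Set
    IsSolution (i , j , r) = r ∈ˢ U × suc (toℕ i) % p ≡ (suc (toℕ j) * toℕ r) % p

    isSolution? : Decidable IsSolution
    isSolution? (i , j , r) = r ∈ˢ? U ×-dec (suc (toℕ i) % p ≟ (suc (toℕ j) * toℕ r) % p)

    triples : List Triple
    triples = cartesianProduct (allFin H) (cartesianProduct (allFin H) (allFin p))

    solutions : List Triple
    solutions = filter isSolution? triples

    solutions-! : Unique solutions
    solutions-! = Uniq.filter⁺ isSolution? (Uniq.cartesianProduct⁺ (Uniq.allFin⁺ H) (Uniq.cartesianProduct⁺ (Uniq.allFin⁺ H) (Uniq.allFin⁺ p)))

    solution : ∀ {s} → s ∈ solutions → IsSolution s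
    solution s∈ = proj₂ (∈-filter⁻ isSolution? {xs = triples} s∈)

    solCount≡ : solCount p H U ≡ length solutions
    solCount≡ = vsum-cartesianProduct isSolution? H id _ _ λ i →
      vsum-cartesianProduct (λ jr → isSolution? (i , jr)) H id _ _ λ j →
      vsum-indicator (λ r → isSolution? (i , j , r)) p id

    -- Given `y` and `r`, the residue of `x` is fixed, and x / p takes at most H / p + 1 values.
    -- This settles the range H ≥ p.
    solCount-trivial : solCount p H U ≤ suc (H / p) * (H * ∣ U ∣)
    solCount-trivial = begin
      solCount p H U ≡⟨ solCount≡ ⟩
      length solutions ≤⟨ length-map-injective (≡-dec _≟_ (≡-dec Fin._≟_ Fin._≟_)) code solutions target solutions-! into inj ⟩
      length target ≡⟨ length-cartesianProduct (upTo (suc (H / p))) (cartesianProduct (allFin H) Us) ⟩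
      length (upTo (suc (H / p))) * length (cartesianProduct (allFin H) Us)
        ≡⟨ cong₂ _*_ (length-upTo (suc (H / p))) (length-cartesianProduct (allFin H) Us) ⟩
      suc (H / p) * (length (allFin H) * length Us) ≡⟨ cong₂ (λ x y → suc (H / p) * (x * y)) (length-tabulate {n = H} id) (length-elements U) ⟩
      suc (H / p) * (H * ∣ U ∣) ∎
      where
      open ≤-Reasoning
      code : Triple → ℕ × Fin H × Fin p
      code (i , j , r) = suc (toℕ i) / p , j , r
      target = cartesianProduct (upTo (suc (H / p))) (cartesianProduct (allFin H) Us)
      into : ∀ {s} → s ∈ solutions → code s ∈ target
      into {i , j , r} s∈ = ∈-cartesianProduct⁺ (∈-upTo⁺ (s≤s (/-monoˡ-≤ p (toℕ<n i))))
        (∈-cartesianProduct⁺ (∈-allFin j) (∈-elements⁺ (proj₁ (solution s∈))))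
      inj : ∀ {s s′} → s ∈ solutions → s′ ∈ solutions → code s ≡ code s′ → s ≡ s′
      inj {i , j , r} {i′ , j′ , r′} s∈ s′∈ eq with refl ← cong proj₂ eq =
        cong (_, j , r) (toℕ-injective (suc-injective (≡%∧≡/⇒≡ (trans (proj₂ (solution s∈)) (sym (proj₂ (solution s′∈)))) (cong proj₁ eq))))

    primitivesBelow : ℕ → List Pair
    primitivesBelow zero = []
    primitivesBelow (suc d) = primitives Us (H / suc d)

    layers : ℕ → List (ℕ × Pair)
    layers zero = []
    layers (suc d) = map (suc d ,_) (primitivesBelow (suc d)) ++ layers d

    length-layers : ∀ n → length (layers n) ≡ sumTo (length ∘ primitivesBelow) n
    length-layers zero = refl
    length-layers (suc d) = trans (length-++ (map layer (primitivesBelow (suc d))))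
      (cong₂ _+_ (length-map layer (primitivesBelow (suc d))) (length-layers d))
      where
      layer : Pair → ℕ × Pair
      layer = suc d ,_

    ∈-layers⁺ : ∀ n {d v} → 1 ≤ d → d ≤ n → v ∈ primitivesBelow d → (d , v) ∈ layers n
    ∈-layers⁺ zero 1≤d d≤n v∈ = contradiction (≤-trans 1≤d d≤n) λ ()
    ∈-layers⁺ (suc n) {d} 1≤d d≤n v∈ with m≤n⇒m<n∨m≡n d≤n
    ... | inj₂ refl = ∈-++⁺ˡ (∈-map⁺ (suc n ,_) v∈)
    ... | inj₁ (s≤s d≤) = ∈-++⁺ʳ (map (suc n ,_) (primitivesBelow (suc n))) (∈-layers⁺ n 1≤d d≤ v∈)

    -- As H < p, the gcd of `x` and `y` can be cancelled from the congruence, and so can `y`; hence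
    -- the pair of `x` and `y` determines `r`.
    solCount≤layers : Prime p → H < p → solCount p H U ≤ length (layers H)
    solCount≤layers prime-p H<p = ≤-trans (≤-reflexive solCount≡) (length-injective Q? solutions (layers H) solutions-! cover (λ {s} {s′} {y} → inj {s} {s′} {y}))
      where
      Q : Triple → ℕ × Pair → Set
      Q (i , j , r) (d , a , b) = suc (toℕ i) ≡ d * a × suc (toℕ j) ≡ d * b
      Q? : ∀ s y → Dec (Q s y)
      Q? (i , j , r) (d , a , b) = (suc (toℕ i) ≟ d * a) ×-dec (suc (toℕ j) ≟ d * b)
      inj : ∀ {s s′ y} → s ∈ solutions → s′ ∈ solutions → Q s y → Q s′ y → s ≡ s′
      inj {i , j , r} {i′ , j′ , r′} s∈ s′∈ (ei , ej) (ei′ , ej′)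
        with refl ← toℕ-injective {i = i} {i′} (suc-injective (trans ei (sym ei′)))
           | refl ← toℕ-injective {i = j} {j′} (suc-injective (trans ej (sym ej′))) =
        cong (λ z → i , j , z) (toℕ-injective (trans (sym (toℕ-% r)) (trans (*-cancel-% prime-p
          (p∤ (s≤s z≤n) (≤-<-trans (toℕ<n j) H<p)) (trans (sym (proj₂ (solution s∈))) (proj₂ (solution s′∈)))) (toℕ-% r′))))
      cover : ∀ {s} → s ∈ solutions → ∃[ y ] y ∈ layers H × Q s y
      cover {i , j , r} s∈ = (g , a , b) , ∈-layers⁺ H 1≤g g≤H (mem g 1≤g a≤ b≤) , sym ga≡x , sym gb≡y
        where
        x = suc (toℕ i)
        y = suc (toℕ j)
        g = gcd x y
        1≤g : 1 ≤ g
        1≤g = n≢0⇒n>0 (gcd[m,n]≢0 x y (inj₁ λ ()))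
        instance
          g≢0 : NonZero g
          g≢0 = >-nonZero 1≤g
        a = x / g
        b = y / g
        ga≡x : g * a ≡ x
        ga≡x = trans (*-comm g a) (m/n*n≡m (gcd[m,n]∣m x y))
        gb≡y : g * b ≡ y
        gb≡y = trans (*-comm g b) (m/n*n≡m (gcd[m,n]∣n x y))
        g≤x : g ≤ x
        g≤x = ∣⇒≤ (gcd[m,n]∣m x y)
        g≤y : g ≤ y
        g≤y = ∣⇒≤ (gcd[m,n]∣n x y)
        g≤H : g ≤ H
        g≤H = ≤-trans g≤x (toℕ<n i)
        a≤ : a ≤ H / g
        a≤ = /-monoˡ-≤ g (toℕ<n i)
        b≤ : b ≤ H / g
        b≤ = /-monoˡ-≤ g (toℕ<n j)
        res : Res (a , b) r
        res = *-cancel-% prime-p (p∤ 1≤g (≤-<-trans g≤H H<p)) (begin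
          (g * a) % p ≡⟨ cong (_% p) ga≡x ⟩
          x % p ≡⟨ proj₂ (solution s∈) ⟩
          (y * toℕ r) % p ≡⟨ cong (λ z → (z * toℕ r) % p) gb≡y ⟨
          (g * b * toℕ r) % p ≡⟨ cong (_% p) (*-assoc g b (toℕ r)) ⟩
          (g * (b * toℕ r)) % p ∎)
          where open ≡-Reasoning
        mem : ∀ d → .{{_ : NonZero d}} → 1 ≤ d → a ≤ H / d → b ≤ H / d → (a , b) ∈ primitivesBelow d
        mem (suc d) _ a≤ b≤ = ∈-primitives⁺ ((m≥n⇒m/n>0 g≤x , a≤) , (m≥n⇒m/n>0 g≤y , b≤))
          (Coprimality.coprime-/gcd x y , lose′ (∈-elements⁺ (proj₁ (solution s∈))) res)
          where
          lose′ : ∀ {u} → u ∈ Us → Res (a , b) u → Any.Any (Res (a , b)) Us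
          lose′ u∈ ru = Any.map (λ { refl → ru }) u∈

    -- The pairs (x , y) = d (a , b) with a, b coprime number Σ_d S(H / d); bounding d S(H / d)
    -- uniformly in d costs only a logarithm.
    solCount-reduce : Prime p → H < p → 1 ≤ H → ∀ e Q R → 1 ≤ e →
      (∀ d .{{_ : NonZero d}} → d ≤ H → (d * length (primitives Us (H / d))) ^ e * Q ≤ R) →
      solCount p H U ^ e * Q ≤ 2 * e ^ e * p * R
    solCount-reduce prime-p H<p 1≤H e Q R 1≤e le with j , H<2^j , 2^j≤ ← binaryLength H 1≤H = begin
      solCount p H U ^ e * Q ≤⟨ *-monoˡ-≤ Q (^-monoˡ-≤ e (≤-trans (solCount≤layers prime-p H<p)
        (≤-trans (≤-reflexive (length-layers H)) (harmonic (length ∘ primitivesBelow) M max j H H<2^j)))) ⟩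
      (j * M) ^ e * Q ≡⟨ cong (_* Q) (^-distribʳ-* e j M) ⟩
      j ^ e * M ^ e * Q ≡⟨ *-assoc (j ^ e) (M ^ e) Q ⟩
      j ^ e * (M ^ e * Q) ≤⟨ *-mono-≤ j^e≤ M^e≤ ⟩
      2 * e ^ e * p * R ∎
      where
      open ≤-Reasoning
      f : ℕ → ℕ
      f d = d * length (primitivesBelow d)
      d₀ = Extrema.argmax f 1 (range H)
      M = f d₀
      d₀-bounds : 1 ≤ d₀ × d₀ ≤ H
      d₀-bounds with Extrema.argmax-sel f 1 (range H)
      ... | inj₁ eq = subst (λ z → 1 ≤ z × z ≤ H) (sym eq) (≤-refl , 1≤H)
      ... | inj₂ d∈ = ∈-range⁻ d∈
      max : ∀ d → 1 ≤ d → f d ≤ M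
      max d@(suc d′) 1≤d with d ≤? H
      ... | yes d≤H = All.lookup (Extrema.f[xs]≤f[argmax] {f = f} 1 (range H)) (∈-range⁺ 1≤d d≤H)
      ... | no d≰H = ≤-trans (≤-reflexive (trans (cong (λ z → d * length (primitives Us z)) (m<n⇒m/n≡0 (≰⇒> d≰H))) (*-zeroʳ d))) z≤n
      bound : ∀ d → 1 ≤ d → d ≤ H → f d ^ e * Q ≤ R
      bound (suc d) _ d≤H = le (suc d) d≤H
      M^e≤ : M ^ e * Q ≤ R
      M^e≤ = bound d₀ (proj₁ d₀-bounds) (proj₂ d₀-bounds)
      -- `j` is the binary length of `H`, and any fixed power of a logarithm fits, up to a constant,
      -- into one factor `p`.
      j^e≤ : j ^ e ≤ 2 * e ^ e * p
      j^e≤ = begin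
        j ^ e ≤⟨ ^-monoˡ-≤ e (n≤1+n j) ⟩
        suc j ^ e ≤⟨ polynomial≤exponential e j ⟩
        e ^ e * 2 ^ j ≤⟨ *-monoʳ-≤ (e ^ e) (≤-trans 2^j≤ (*-monoʳ-≤ 2 (<⇒≤ H<p))) ⟩
        e ^ e * (2 * p) ≡⟨ solve₁ (e ^ e) p ⟩
        2 * e ^ e * p ∎
        where
        solve₁ : ∀ a b → a * (2 * b) ≡ 2 * a * b
        solve₁ = solve-∀

-- Choosing the exponent

^-comm : ∀ x m n → (x ^ m) ^ n ≡ (x ^ n) ^ m
^-comm x m n = trans (^-*-assoc x m n) (trans (cong (x ^_) (*-comm m n)) (sym (^-*-assoc x n m)))

^-double : ∀ x c k → x ^ (c * (k * 2)) ≡ (x ^ (c * k)) ^ 2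
^-double x c k = trans (cong (x ^_) (sym (*-assoc c k 2))) (sym (^-*-assoc x (c * k) 2))

+-^-≤ : ∀ n x y → (x + y) ^ n ≤ 2 ^ n * (x ^ n + y ^ n)
+-^-≤ n x y with ≤-total x y
... | inj₁ x≤y = begin
  (x + y) ^ n ≤⟨ ^-monoˡ-≤ n (≤-trans (+-monoˡ-≤ y x≤y) (≤-reflexive (cong (y +_) (sym (+-identityʳ y))))) ⟩
  (2 * y) ^ n ≡⟨ ^-distribʳ-* n 2 y ⟩
  2 ^ n * y ^ n ≤⟨ *-monoʳ-≤ (2 ^ n) (m≤n+m (y ^ n) (x ^ n)) ⟩
  2 ^ n * (x ^ n + y ^ n) ∎
  where open ≤-Reasoning
... | inj₂ y≤x = begin
  (x + y) ^ n ≤⟨ ^-monoˡ-≤ n (≤-trans (+-monoʳ-≤ x y≤x) (≤-reflexive (cong (x +_) (sym (+-identityʳ x))))) ⟩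
  (2 * x) ^ n ≡⟨ ^-distribʳ-* n 2 x ⟩
  2 ^ n * x ^ n ≤⟨ *-monoʳ-≤ (2 ^ n) (m≤m+n (x ^ n) (y ^ n)) ⟩
  2 ^ n * (x ^ n + y ^ n) ∎
  where open ≤-Reasoning

minimalExponent : ∀ u L κ → 1 ≤ κ → u ≤ L ^ κ → ∃[ j ] suc j ≤ κ × u ≤ L ^ suc j × (j ≡ 0 ⊎ L ^ j < u)
minimalExponent u L (suc zero) _ le = 0 , ≤-refl , le , inj₁ refl
minimalExponent u L (suc κ@(suc _)) _ le with u ≤? L ^ κ | minimalExponent u L κ (s≤s z≤n)
... | no ¬le  | _   = κ , ≤-refl , le , inj₂ (≰⇒> ¬le)
... | yes le′ | rec = let j , j< , u≤ , min = rec le′ in j , m≤n⇒m≤1+n j< , u≤ , min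

-- From L^j < u one gets (u L^(j+1))^j ≤ u^(2j+1). As j / (2j + 1) increases with `j`, the size
-- hypothesis for `n` implies u^(2j+1) ≤ p^j.
u*L^[1+j]≤p : ∀ n u p L j → 1 ≤ n → n ≤ j → u ^ (2 * n + 1) < p ^ n → L ^ j < u → u * L ^ suc j ≤ p
u*L^[1+j]≤p n u p L j 1≤n n≤j u< L< = ^-cancelˡ-≤ j (≤-trans 1≤n n≤j) (begin
  (u * L ^ suc j) ^ j ≡⟨ ^-distribʳ-* j u (L ^ suc j) ⟩
  u ^ j * (L ^ suc j) ^ j ≡⟨ cong (u ^ j *_) (^-comm L (suc j) j) ⟩
  u ^ j * (L ^ j) ^ suc j ≤⟨ *-monoʳ-≤ (u ^ j) (^-monoˡ-≤ (suc j) (<⇒≤ L<)) ⟩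
  u ^ j * u ^ suc j ≡⟨ ^-distribˡ-+-* u j (suc j) ⟨
  u ^ (j + suc j) ≡⟨ cong (u ^_) (solve₁ j) ⟩
  u ^ (2 * j + 1) ≤⟨ ^-cancelˡ-≤ n 1≤n lifted ⟩
  p ^ j ∎)
  where
  open ≤-Reasoning
  solve₁ : ∀ j → j + suc j ≡ 2 * j + 1
  solve₁ = solve-∀
  solve₂ : ∀ j n → 2 * j * n + j ≡ (2 * n + 1) * j
  solve₂ = solve-∀
  lifted : (u ^ (2 * j + 1)) ^ n ≤ (p ^ j) ^ n
  lifted = begin
    (u ^ (2 * j + 1)) ^ n ≡⟨ ^-*-assoc u (2 * j + 1) n ⟩
    u ^ ((2 * j + 1) * n) ≡⟨ cong (u ^_) (trans (*-distribʳ-+ n (2 * j) 1) (cong (2 * j * n +_) (+-identityʳ n))) ⟩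
    u ^ (2 * j * n + n) ≤⟨ ^-monoʳ-≤ u {{>-nonZero (≤-trans (s≤s z≤n) L<)}} (+-monoʳ-≤ (2 * j * n) n≤j) ⟩
    u ^ (2 * j * n + j) ≡⟨ cong (u ^_) (solve₂ j n) ⟩
    u ^ ((2 * n + 1) * j) ≡⟨ ^-*-assoc u (2 * n + 1) j ⟨
    (u ^ (2 * n + 1)) ^ j ≤⟨ ^-monoˡ-≤ j (<⇒≤ u<) ⟩
    (p ^ n) ^ j ≡⟨ ^-comm p n j ⟩
    (p ^ j) ^ n ∎

module Bounds (S T u p L : ℕ) .{{_ : NonZero p}}
  where

  PowerBound : ℕ → Set
  PowerBound m = S ^ m * p ≤ T * u * (p + 2 * (L ^ m * L ^ m))

  -- The two conditions on u and L^m make both terms of `PowerBound m` at most a constant times T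
  -- L^m p, so S^m ≤ 3 T L^m. In place of an m-th root, this is raised to the power `κ` and the
  -- exponent `m` is cancelled.
  linearBound : ∀ κ C m → 1 ≤ m → T ^ κ ≤ C * p → PowerBound m → u ≤ L ^ m → u * L ^ m ≤ p →
    S ^ κ ≤ 3 ^ κ * C * L ^ κ * p
  linearBound κ C m 1≤m T^κ≤ bound u≤ uL≤ = ^-cancelˡ-≤ m 1≤m (begin
    (S ^ κ) ^ m ≡⟨ ^-comm S κ m ⟩
    (S ^ m) ^ κ ≤⟨ ^-monoˡ-≤ κ S^m≤ ⟩
    (3 * T * L ^ m) ^ κ ≡⟨ trans (^-distribʳ-* κ (3 * T) (L ^ m)) (cong (_* (L ^ m) ^ κ) (^-distribʳ-* κ 3 T)) ⟩
    3 ^ κ * T ^ κ * (L ^ m) ^ κ ≤⟨ *-monoˡ-≤ ((L ^ m) ^ κ) (*-monoʳ-≤ (3 ^ κ) T^κ≤) ⟩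
    3 ^ κ * (C * p) * (L ^ m) ^ κ ≡⟨ cong (3 ^ κ * (C * p) *_) (^-comm L m κ) ⟩
    3 ^ κ * (C * p) * (L ^ κ) ^ m ≤⟨ *-monoˡ-≤ ((L ^ κ) ^ m) (n≤n^ m (3 ^ κ * (C * p)) 1≤m) ⟩
    (3 ^ κ * (C * p)) ^ m * (L ^ κ) ^ m ≡⟨ ^-distribʳ-* m (3 ^ κ * (C * p)) (L ^ κ) ⟨
    (3 ^ κ * (C * p) * L ^ κ) ^ m ≡⟨ cong (_^ m) (solve₁ (3 ^ κ) C p (L ^ κ)) ⟩
    (3 ^ κ * C * L ^ κ * p) ^ m ∎)
    where
    open ≤-Reasoning
    solve₁ : ∀ a c p l → a * (c * p) * l ≡ a * c * l * p
    solve₁ = solve-∀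
    solve₂ : ∀ t u p l → t * u * (p + 2 * (l * l)) ≡ t * (u * p + 2 * (u * l) * l)
    solve₂ = solve-∀
    solve₃ : ∀ t l p → t * (l * p + 2 * p * l) ≡ 3 * t * l * p
    solve₃ = solve-∀
    S^m≤ : S ^ m ≤ 3 * T * L ^ m
    S^m≤ = *-cancelʳ-≤ (S ^ m) (3 * T * L ^ m) p (begin
      S ^ m * p ≤⟨ bound ⟩
      T * u * (p + 2 * (L ^ m * L ^ m)) ≡⟨ solve₂ T u p (L ^ m) ⟩
      T * (u * p + 2 * (u * L ^ m) * L ^ m) ≤⟨ *-monoʳ-≤ T (+-mono-≤ (*-monoˡ-≤ p u≤) (*-monoˡ-≤ (L ^ m) (*-monoʳ-≤ 2 uL≤))) ⟩
      T * (L ^ m * p + 2 * p * L ^ m) ≡⟨ solve₃ T (L ^ m) p ⟩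
      3 * T * L ^ m * p ∎)

  trivialBound : ∀ κ → S ≤ L * L → L ^ κ ≤ p → S ^ κ ≤ L ^ κ * p
  trivialBound κ S≤ L^κ≤p = begin
    S ^ κ ≤⟨ ^-monoˡ-≤ κ S≤ ⟩
    (L * L) ^ κ ≡⟨ ^-distribʳ-* κ L L ⟩
    L ^ κ * L ^ κ ≤⟨ *-monoʳ-≤ (L ^ κ) L^κ≤p ⟩
    L ^ κ * p ∎
    where open ≤-Reasoning

  -- When the least exponent is at most `n`, its upper condition follows from u L^n < p; when it is
  -- larger, from the size of `u` through `u*L^[1+j]≤p`.
  primitiveBound₁ : ∀ n κ C → 1 ≤ n → 1 ≤ κ → T ^ κ ≤ C * p → (∀ m → m ≤ κ → PowerBound m) →
    S ≤ L * L → u ≤ p → 1 ≤ L → u ^ (2 * n + 1) < p ^ n → u * L ^ n < p →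
    S ^ κ ≤ (1 + 3 ^ κ * C) * L ^ κ * p
  primitiveBound₁ n κ C 1≤n 1≤κ T^κ≤ bound S≤ u≤p 1≤L u< uL^n< with L ^ κ ≤? p
  ... | yes L^κ≤p = begin
    S ^ κ ≤⟨ trivialBound κ S≤ L^κ≤p ⟩
    L ^ κ * p ≡⟨ cong (_* p) (*-identityˡ (L ^ κ)) ⟨
    1 * L ^ κ * p ≤⟨ *-monoˡ-≤ p (*-monoˡ-≤ (L ^ κ) (m≤m+n 1 (3 ^ κ * C))) ⟩
    (1 + 3 ^ κ * C) * L ^ κ * p ∎
    where open ≤-Reasoning
  ... | no L^κ≰p with j , j<κ , u≤ , min ← minimalExponent u L κ 1≤κ (≤-trans u≤p (<⇒≤ (≰⇒> L^κ≰p))) = begin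
    S ^ κ ≤⟨ linearBound κ C (suc j) (s≤s z≤n) T^κ≤ (bound (suc j) j<κ) u≤ (uL≤p min) ⟩
    3 ^ κ * C * L ^ κ * p ≤⟨ *-monoˡ-≤ p (*-monoˡ-≤ (L ^ κ) (m≤n+m (3 ^ κ * C) 1)) ⟩
    (1 + 3 ^ κ * C) * L ^ κ * p ∎
    where
    open ≤-Reasoning
    uL≤p : j ≡ 0 ⊎ L ^ j < u → u * L ^ suc j ≤ p
    uL≤p min with suc j ≤? n | min
    ... | yes j<n | _ = ≤-trans (*-monoʳ-≤ u (^-monoʳ-≤ L {{>-nonZero 1≤L}} j<n)) (<⇒≤ uL^n<)
    ... | no j≮n | inj₁ refl = contradiction 1≤n j≮n
    ... | no j≮n | inj₂ L^j<u = u*L^[1+j]≤p n u p L j 1≤n (≮⇒≥ j≮n) u< L^j<u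

  -- L < u ≤ L²: the geometric mean of the bounds for m = 1 and m = 2.
  geometricMean : PowerBound 1 → PowerBound 2 → L * L ≤ p → u ≤ L ^ 2 → p ≤ u * L ^ 2 →
    S ^ 4 * p ≤ 27 * T ^ 3 * (u ^ 3 * L ^ 4)
  geometricMean bound₁ bound₂ LL≤p u≤ p≤ = begin
    S ^ 4 * p ≡⟨ solve₁ S p ⟩
    S * S * (S ^ 2 * p) ≤⟨ *-mono-≤ (*-mono-≤ S≤ S≤) S²p≤ ⟩
    3 * T * u * (3 * T * u) * (3 * T * u * L ^ 2 * L ^ 2) ≡⟨ solve₂ T u L ⟩
    27 * T ^ 3 * (u ^ 3 * L ^ 4) ∎
    where
    open ≤-Reasoning
    solve₁ : ∀ s p → s * (s * (s * (s * 1))) * p ≡ s * s * (s * (s * 1) * p)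
    solve₁ = solve-∀
    solve₂ : ∀ t u l → 3 * t * u * (3 * t * u) * (3 * t * u * (l * (l * 1)) * (l * (l * 1)))
      ≡ 27 * (t * (t * (t * 1))) * (u * (u * (u * 1)) * (l * (l * (l * (l * 1)))))
    solve₂ = solve-∀
    solve₃ : ∀ t u p → t * u * (p + 2 * p) ≡ 3 * t * u * p
    solve₃ = solve-∀
    solve₄ : ∀ t u p l → t * u * (p + 2 * (l * l)) ≡ t * (u * p + 2 * u * l * l)
    solve₄ = solve-∀
    solve₅ : ∀ t u l → t * (l * (u * l) + 2 * u * l * l) ≡ 3 * t * u * l * l
    solve₅ = solve-∀
    S≤ : S ≤ 3 * T * u
    S≤ = *-cancelʳ-≤ S (3 * T * u) p (begin
      S * p ≡⟨ cong (_* p) (*-identityʳ S) ⟨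
      S ^ 1 * p ≤⟨ bound₁ ⟩
      T * u * (p + 2 * (L ^ 1 * L ^ 1)) ≡⟨ cong (λ l → T * u * (p + 2 * (l * l))) (*-identityʳ L) ⟩
      T * u * (p + 2 * (L * L)) ≤⟨ *-monoʳ-≤ (T * u) (+-monoʳ-≤ p (*-monoʳ-≤ 2 LL≤p)) ⟩
      T * u * (p + 2 * p) ≡⟨ solve₃ T u p ⟩
      3 * T * u * p ∎)
    S²p≤ : S ^ 2 * p ≤ 3 * T * u * L ^ 2 * L ^ 2
    S²p≤ = begin
      S ^ 2 * p ≤⟨ bound₂ ⟩
      T * u * (p + 2 * (L ^ 2 * L ^ 2)) ≡⟨ solve₄ T u p (L ^ 2) ⟩
      T * (u * p + 2 * u * L ^ 2 * L ^ 2) ≤⟨ *-monoʳ-≤ T (+-monoˡ-≤ (2 * u * L ^ 2 * L ^ 2) (*-mono-≤ u≤ p≤)) ⟩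
      T * (L ^ 2 * (u * L ^ 2) + 2 * u * L ^ 2 * L ^ 2) ≡⟨ solve₅ T u (L ^ 2) ⟩
      3 * T * u * L ^ 2 * L ^ 2 ∎

-- The right-hand side of part (ii), raised to the power 4 k and multiplied by p ^ (4 k).
rhs₂ : ℕ → ℕ → ℕ → ℕ → ℕ
rhs₂ u p k H = (H * p) ^ (4 * k) + (u * H ^ 2) ^ (4 * k) + u ^ (3 * k) * H ^ (4 * k) * p ^ (3 * k)

module Bounds₂ (S T u p L k C : ℕ) .{{_ : NonZero p}} where
  open Bounds S T u p L
  open ≤-Reasoning

  κ = 4 * k
  -- The 1 serves the trivial bound, 4^κ serves `case₁` (as 2^κ twice) and the linear bounds (which
  -- need 3^κ), and 27^κ serves the geometric mean.
  D = 1 + (4 ^ κ + 27 ^ κ) * C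
  R = rhs₂ u p k L

  term₁ : (L * p) ^ κ ≤ R
  term₁ = ≤-trans (m≤m+n _ _) (m≤m+n _ _)

  term₃ : u ^ (3 * k) * L ^ κ * p ^ (3 * k) ≤ R
  term₃ = m≤n+m _ _

  term₁₂ : (L * p) ^ κ + (u * L ^ 2) ^ κ ≤ R
  term₁₂ = m≤m+n _ _

  4^κC≤D : 4 ^ κ * C ≤ D
  4^κC≤D = ≤-trans (*-monoˡ-≤ C (m≤m+n (4 ^ κ) (27 ^ κ))) (m≤n+m _ 1)

  linear : ∀ B → B ≤ D → S ^ κ ≤ B * L ^ κ * p → (S * p) ^ κ ≤ D * p * R
  linear B B≤D le = begin
    (S * p) ^ κ ≡⟨ ^-distribʳ-* κ S p ⟩
    S ^ κ * p ^ κ ≤⟨ *-monoˡ-≤ (p ^ κ) le ⟩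
    B * L ^ κ * p * p ^ κ ≡⟨ solve₁ B (L ^ κ) p (p ^ κ) ⟩
    B * p * (L ^ κ * p ^ κ) ≡⟨ cong (B * p *_) (^-distribʳ-* κ L p) ⟨
    B * p * (L * p) ^ κ ≤⟨ *-mono-≤ (*-monoˡ-≤ p B≤D) term₁ ⟩
    D * p * R ∎
    where
    solve₁ : ∀ b l p q → b * l * p * q ≡ b * p * (l * q)
    solve₁ = solve-∀

  -- With u ≤ L, the first term of the bound for m = 1 becomes the term H of part (ii), and the
  -- second is already |U| H² / p.
  case₁ : T ^ κ ≤ C * p → PowerBound 1 → u ≤ L ^ 1 → (S * p) ^ κ ≤ D * p * R
  case₁ T^κ≤ bound u≤ = begin
    (S * p) ^ κ ≤⟨ ^-monoˡ-≤ κ Sp≤ ⟩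
    (2 * T * (L * p + u * L ^ 2)) ^ κ ≡⟨ trans (^-distribʳ-* κ (2 * T) _) (cong (_* (L * p + u * L ^ 2) ^ κ) (^-distribʳ-* κ 2 T)) ⟩
    2 ^ κ * T ^ κ * (L * p + u * L ^ 2) ^ κ ≤⟨ *-mono-≤ (*-monoʳ-≤ (2 ^ κ) T^κ≤) (+-^-≤ κ (L * p) (u * L ^ 2)) ⟩
    2 ^ κ * (C * p) * (2 ^ κ * ((L * p) ^ κ + (u * L ^ 2) ^ κ)) ≤⟨ *-monoʳ-≤ (2 ^ κ * (C * p)) (*-monoʳ-≤ (2 ^ κ) term₁₂) ⟩
    2 ^ κ * (C * p) * (2 ^ κ * R) ≡⟨ solve₁ (2 ^ κ) C p R ⟩
    2 ^ κ * 2 ^ κ * C * p * R ≡⟨ cong (λ z → z * C * p * R) (^-distribʳ-* κ 2 2) ⟨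
    4 ^ κ * C * p * R ≤⟨ *-monoˡ-≤ R (*-monoˡ-≤ p 4^κC≤D) ⟩
    D * p * R ∎
    where
    solve₁ : ∀ a c p r → a * (c * p) * (a * r) ≡ a * a * c * p * r
    solve₁ = solve-∀
    solve₂ : ∀ t u p l → t * u * (p + 2 * (l * 1 * (l * 1))) ≡ t * (u * p + 2 * (u * (l * (l * 1))))
    solve₂ = solve-∀
    solve₃ : ∀ t x y → t * (2 * x + 2 * y) ≡ 2 * t * (x + y)
    solve₃ = solve-∀
    Sp≤ : S * p ≤ 2 * T * (L * p + u * L ^ 2)
    Sp≤ = begin
      S * p ≡⟨ cong (_* p) (*-identityʳ S) ⟨
      S ^ 1 * p ≤⟨ bound ⟩
      T * u * (p + 2 * (L ^ 1 * L ^ 1)) ≡⟨ solve₂ T u p L ⟩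
      T * (u * p + 2 * (u * L ^ 2)) ≤⟨ *-monoʳ-≤ T (+-monoˡ-≤ (2 * (u * L ^ 2)) (≤-trans (*-monoˡ-≤ p (≤-trans u≤ (≤-reflexive (*-identityʳ L)))) (m≤m+n (L * p) _))) ⟩
      T * (2 * (L * p) + 2 * (u * L ^ 2)) ≡⟨ solve₃ T (L * p) (u * L ^ 2) ⟩
      2 * T * (L * p + u * L ^ 2) ∎

  -- The k-th power of the geometric mean, multiplied by p^(3k), has the third term of `rhs₂` on the
  -- right. Enlarging T^(3k) to T^κ keeps the loss at one factor `p`.
  case₂ : 1 ≤ T → T ^ κ ≤ C * p → S ^ 4 * p ≤ 27 * T ^ 3 * (u ^ 3 * L ^ 4) → (S * p) ^ κ ≤ D * p * R
  case₂ 1≤T T^κ≤ le = begin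
    (S * p) ^ (4 * k) ≡⟨ ^-*-assoc (S * p) 4 k ⟨
    ((S * p) ^ 4) ^ k ≡⟨ cong (_^ k) (trans (^-distribʳ-* 4 S p) (sym (*-assoc (S ^ 4) p (p ^ 3)))) ⟩
    (S ^ 4 * p * p ^ 3) ^ k ≤⟨ ^-monoˡ-≤ k (*-monoˡ-≤ (p ^ 3) le) ⟩
    (27 * T ^ 3 * (u ^ 3 * L ^ 4) * p ^ 3) ^ k ≡⟨ spread ⟩
    27 ^ k * T ^ (3 * k) * (u ^ (3 * k) * L ^ (4 * k) * p ^ (3 * k))
      ≤⟨ *-mono-≤ (*-mono-≤ (^-monoʳ-≤ 27 (m≤n*m k 4)) (≤-trans (^-monoʳ-≤ T {{>-nonZero 1≤T}} (*-monoˡ-≤ k (s≤s (s≤s (s≤s (z≤n {1})))))) T^κ≤)) term₃ ⟩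
    27 ^ κ * (C * p) * R ≡⟨ cong (_* R) (*-assoc (27 ^ κ) C p) ⟨
    27 ^ κ * C * p * R ≤⟨ *-monoˡ-≤ R (*-monoˡ-≤ p (≤-trans (*-monoˡ-≤ C (m≤n+m (27 ^ κ) (4 ^ κ))) (m≤n+m _ 1))) ⟩
    D * p * R ∎
    where
    spread : (27 * T ^ 3 * (u ^ 3 * L ^ 4) * p ^ 3) ^ k ≡ 27 ^ k * T ^ (3 * k) * (u ^ (3 * k) * L ^ (4 * k) * p ^ (3 * k))
    spread = begin-equality
      (27 * T ^ 3 * (u ^ 3 * L ^ 4) * p ^ 3) ^ k ≡⟨ ^-distribʳ-* k (27 * T ^ 3 * (u ^ 3 * L ^ 4)) (p ^ 3) ⟩
      (27 * T ^ 3 * (u ^ 3 * L ^ 4)) ^ k * (p ^ 3) ^ k ≡⟨ cong (_* (p ^ 3) ^ k) (^-distribʳ-* k (27 * T ^ 3) (u ^ 3 * L ^ 4)) ⟩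
      (27 * T ^ 3) ^ k * (u ^ 3 * L ^ 4) ^ k * (p ^ 3) ^ k
        ≡⟨ cong₂ (λ x y → x * y * (p ^ 3) ^ k) (^-distribʳ-* k 27 (T ^ 3)) (^-distribʳ-* k (u ^ 3) (L ^ 4)) ⟩
      27 ^ k * (T ^ 3) ^ k * ((u ^ 3) ^ k * (L ^ 4) ^ k) * (p ^ 3) ^ k
        ≡⟨ cong₂ (λ x y → 27 ^ k * x * y * (p ^ 3) ^ k) (^-*-assoc T 3 k) (cong₂ _*_ (^-*-assoc u 3 k) (^-*-assoc L 4 k)) ⟩
      27 ^ k * T ^ (3 * k) * (u ^ (3 * k) * L ^ (4 * k)) * (p ^ 3) ^ k
        ≡⟨ cong (27 ^ k * T ^ (3 * k) * (u ^ (3 * k) * L ^ (4 * k)) *_) (^-*-assoc p 3 k) ⟩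
      27 ^ k * T ^ (3 * k) * (u ^ (3 * k) * L ^ (4 * k)) * p ^ (3 * k) ≡⟨ *-assoc (27 ^ k * T ^ (3 * k)) _ _ ⟩
      27 ^ k * T ^ (3 * k) * (u ^ (3 * k) * L ^ (4 * k) * p ^ (3 * k)) ∎

  -- The hypothesis u^5 < p^2 is the size condition of part (i) for n = 2, so it disposes of every
  -- least exponent from 3 on. Exponent 2 splits according to whether u L² ≤ p.
  primitiveBound₂ : 1 ≤ k → 1 ≤ T → T ^ κ ≤ C * p → (∀ m → m ≤ κ → PowerBound m) →
    S ≤ L * L → u ≤ p → u ^ 5 < p ^ 2 → (S * p) ^ κ ≤ D * p * R
  primitiveBound₂ 1≤k 1≤T T^κ≤ bound S≤ u≤p u< with L ^ κ ≤? p
  ... | yes L^κ≤p = linear 1 (m≤m+n 1 _) (≤-trans (trivialBound κ S≤ L^κ≤p) (≤-reflexive (cong (_* p) (sym (*-identityˡ (L ^ κ))))))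
  ... | no L^κ≰p = go (minimalExponent u L κ (≤-trans (s≤s z≤n) 4≤κ) (≤-trans u≤p (<⇒≤ (≰⇒> L^κ≰p))))
    where
    4≤κ : 4 ≤ κ
    4≤κ = *-monoʳ-≤ 4 1≤k
    viaLinear : ∀ m → 1 ≤ m → m ≤ κ → u ≤ L ^ m → u * L ^ m ≤ p → (S * p) ^ κ ≤ D * p * R
    viaLinear m 1≤m m≤κ u≤ uL≤ = linear (3 ^ κ * C) (≤-trans (*-monoˡ-≤ C (^-monoˡ-≤ κ (n≤1+n 3))) 4^κC≤D)
      (linearBound κ C m 1≤m T^κ≤ (bound m m≤κ) u≤ uL≤)
    go : ∃[ j ] suc j ≤ κ × u ≤ L ^ suc j × (j ≡ 0 ⊎ L ^ j < u) → (S * p) ^ κ ≤ D * p * R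
    go (zero , 1≤κ , u≤ , _) = case₁ T^κ≤ (bound 1 1≤κ) u≤
    go (j@(suc (suc _)) , j<κ , u≤ , inj₂ L^j<u) = viaLinear (suc j) (s≤s z≤n) j<κ u≤
      (u*L^[1+j]≤p 2 u p L j (s≤s z≤n) (s≤s (s≤s z≤n)) u< L^j<u)
    go (suc zero , 2≤κ , u≤ , inj₂ L^1<u) with u * L ^ 2 ≤? p
    ... | yes uL≤ = viaLinear 2 (s≤s z≤n) 2≤κ u≤ uL≤
    ... | no uL≰ = case₂ 1≤T T^κ≤ (geometricMean (bound 1 (≤-trans (s≤s z≤n) 2≤κ)) (bound 2 2≤κ) LL≤p u≤ (<⇒≤ (≰⇒> uL≰)))
      where
      L<u : L < u
      L<u = subst (_< u) (*-identityʳ L) L^1<u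
      LL≤p : L * L ≤ p
      LL≤p = ≤-trans (*-mono-≤ (<⇒≤ L<u) (<⇒≤ L<u)) (^-cancelˡ-≤ 2 (s≤s z≤n) (begin
        (u * u) ^ 2 ≡⟨ solve₁ u ⟩
        u ^ 4 ≤⟨ ^-monoʳ-≤ u {{>-nonZero (≤-trans (s≤s z≤n) L<u)}} (n≤1+n 4) ⟩
        u ^ 5 ≤⟨ <⇒≤ u< ⟩
        p ^ 2 ∎))
        where
        solve₁ : ∀ u → u * u * (u * u * 1) ≡ u * (u * (u * (u * 1)))
        solve₁ = solve-∀

-- The two parts of the theorem

doubling⇒nonempty : ∀ {c K u} → c < K * u → 1 ≤ u
doubling⇒nonempty {c} {K} {zero} lt = contradiction (subst (c <_) (*-zeroʳ K) lt) n≮0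
doubling⇒nonempty {u = suc _} _ = s≤s z≤n

d*[H/d]≤H : ∀ d H .{{_ : NonZero d}} → d * (H / d) ≤ H
d*[H/d]≤H d H = ≤-trans (≤-reflexive (*-comm d (H / d))) (m/n*n≤m H d)

module _ (p : ℕ) .{{_ : NonZero p}} (H : ℕ) (U : Subset p) where
  open Solutions p U using (Us; solCount-trivial; solCount-reduce; smallDoubling)

  -- The exponent is doubled because the logarithm and `T` cost a factor `p` each; the final square
  -- root turns p² into `p`.
  part₁ : ∀ n k C T → 1 ≤ n → 1 ≤ k → Prime p → 1 ≤ H → T ^ (k * 2) ≤ C * p →
    Residues.PowerBounds p 10 (k * 2) T →
    InUnits p U → ∣ prodSet p U ∣ < 10 * ∣ U ∣ → ∣ U ∣ ^ (2 * n + 1) < p ^ n → ∣ U ∣ * H ^ n < p →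
    solCount p H U ^ k ≤ 2 * (k * 2) ^ (k * 2) * (1 + 3 ^ (k * 2) * C) * H ^ k * p
  part₁ n k C T 1≤n 1≤k prime-p 1≤H T≤ bounds units small u< uH^n< = ^-cancelˡ-≤ 2 (s≤s z≤n) (begin
    (J ^ k) ^ 2 ≡⟨ ^-*-assoc J k 2 ⟩
    J ^ e ≡⟨ *-identityʳ (J ^ e) ⟨
    J ^ e * 1 ≤⟨ solCount-reduce H prime-p H<p 1≤H e 1 (B * H ^ e * p) 1≤e step ⟩
    2 * e ^ e * p * (B * H ^ e * p) ≡⟨ solve₁ (2 * e ^ e) B (H ^ e) p ⟩
    2 * e ^ e * B * (H ^ e * (p * (p * 1))) ≤⟨ *-mono-≤ (n≤n^ 2 (2 * e ^ e * B) (s≤s z≤n)) (≤-reflexive (cong (_* p ^ 2) (sym (^-*-assoc H k 2)))) ⟩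
    (2 * e ^ e * B) ^ 2 * ((H ^ k) ^ 2 * p ^ 2) ≡⟨ solve₂ (2 * e ^ e * B) (H ^ k) p ⟩
    (2 * e ^ e * B * H ^ k * p) ^ 2 ∎)
    where
    open ≤-Reasoning
    J = solCount p H U
    e = k * 2
    B = 1 + 3 ^ e * C
    u = ∣ U ∣
    1≤e : 1 ≤ e
    1≤e = *-positive 1≤k (s≤s z≤n)
    solve₁ : ∀ a b h p → a * p * (b * h * p) ≡ a * b * (h * (p * (p * 1)))
    solve₁ = solve-∀
    solve₂ : ∀ a h p → a * (a * 1) * (h * (h * 1) * (p * (p * 1))) ≡ a * h * p * (a * h * p * 1)
    solve₂ = solve-∀
    1≤u : 1 ≤ u
    1≤u = doubling⇒nonempty {K = 10} small
    -- The strict doubling inequality makes `U` nonempty, hence H ≤ |U| H^n.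
    H<p : H < p
    H<p = ≤-<-trans (≤-trans (n≤n^ n H 1≤n) (≤-trans (≤-reflexive (sym (*-identityˡ (H ^ n)))) (*-monoˡ-≤ (H ^ n) 1≤u))) uH^n<
    step : ∀ d .{{_ : NonZero d}} → d ≤ H → (d * length (Residues.primitives p Us (H / d))) ^ e * 1 ≤ B * H ^ e * p
    step d d≤H = begin
      (d * S) ^ e * 1 ≡⟨ trans (*-identityʳ _) (^-distribʳ-* e d S) ⟩
      d ^ e * S ^ e ≤⟨ *-monoʳ-≤ (d ^ e) (Bounds.primitiveBound₁ S T u p L n e C 1≤n 1≤e T≤
        (λ m m≤e → subst (λ z → S ^ m * p ≤ T * z * (p + 2 * (L ^ m * L ^ m))) (length-elements U)
          (bounds Us (smallDoubling 10 units small) L m 1≤L (≤-trans L≤H (<⇒≤ H<p)) m≤e))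
        (Residues.length-primitives p Us L) (∣p∣≤n U) 1≤L u< (≤-<-trans (*-monoʳ-≤ u (^-monoˡ-≤ n L≤H)) uH^n<)) ⟩
      d ^ e * (B * L ^ e * p) ≡⟨ solve₃ (d ^ e) B (L ^ e) p ⟩
      B * (d ^ e * L ^ e) * p ≡⟨ cong (λ z → B * z * p) (^-distribʳ-* e d L) ⟨
      B * (d * L) ^ e * p ≤⟨ *-monoˡ-≤ p (*-monoʳ-≤ B (^-monoˡ-≤ e (d*[H/d]≤H d H))) ⟩
      B * H ^ e * p ∎
      where
      L = H / d
      S = length (Residues.primitives p Us L)
      L≤H : L ≤ H
      L≤H = ≤-trans (m≤n*m L d) (d*[H/d]≤H d H)
      1≤L : 1 ≤ L
      1≤L = m≥n⇒m/n>0 d≤H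
      solve₃ : ∀ d b l p → d * (b * l * p) ≡ b * (d * l) * p
      solve₃ = solve-∀

  -- For H ≥ p the trivial count is already of the order |U| H² / p.
  part₂-large : ∀ k → p ≤ H → (solCount p H U * p) ^ (4 * k) ≤ 2 ^ (4 * k) * p * rhs₂ ∣ U ∣ p k H
  part₂-large k p≤H = begin
    (solCount p H U * p) ^ κ ≤⟨ ^-monoˡ-≤ κ Jp≤ ⟩
    (2 * (u * H ^ 2)) ^ κ ≡⟨ ^-distribʳ-* κ 2 (u * H ^ 2) ⟩
    2 ^ κ * (u * H ^ 2) ^ κ ≤⟨ *-mono-≤ (m≤m*n (2 ^ κ) p) (≤-trans (m≤n+m ((u * H ^ 2) ^ κ) ((H * p) ^ κ)) (m≤m+n _ _)) ⟩
    2 ^ κ * p * rhs₂ u p k H ∎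
    where
    open ≤-Reasoning
    κ = 4 * k
    u = ∣ U ∣
    solve₁ : ∀ s h u p → s * (h * u) * p ≡ s * p * (h * u)
    solve₁ = solve-∀
    solve₂ : ∀ h u → (h + h) * (h * u) ≡ 2 * (u * (h * (h * 1)))
    solve₂ = solve-∀
    Jp≤ : solCount p H U * p ≤ 2 * (u * H ^ 2)
    Jp≤ = begin
      solCount p H U * p ≤⟨ *-monoˡ-≤ p (solCount-trivial H) ⟩
      suc (H / p) * (H * u) * p ≡⟨ solve₁ (suc (H / p)) H u p ⟩
      (p + H / p * p) * (H * u) ≤⟨ *-monoˡ-≤ (H * u) (+-mono-≤ p≤H (m/n*n≤m H p)) ⟩
      (H + H) * (H * u) ≡⟨ solve₂ H u ⟩
      2 * (u * H ^ 2) ∎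

  -- Before the power 4k is taken, each term has degree at least 1 in `H`, so d (H / d) ≤ H absorbs
  -- the factor `d` that multiplies S(H / d).
  rhs₂-scale : ∀ u k d .{{_ : NonZero d}} → d ^ (4 * k) * rhs₂ u p k (H / d) ≤ rhs₂ u p k H
  rhs₂-scale u k d = begin
    d ^ κ * ((L * p) ^ κ + (u * L ^ 2) ^ κ + u ^ (3 * k) * L ^ κ * p ^ (3 * k))
      ≡⟨ solve₁ (d ^ κ) ((L * p) ^ κ) ((u * L ^ 2) ^ κ) (u ^ (3 * k)) (L ^ κ) (p ^ (3 * k)) ⟩
    d ^ κ * (L * p) ^ κ + d ^ κ * (u * L ^ 2) ^ κ + u ^ (3 * k) * (d ^ κ * L ^ κ) * p ^ (3 * k)
      ≡⟨ cong₂ _+_ (cong₂ _+_ (^-distribʳ-* κ d (L * p)) (^-distribʳ-* κ d (u * L ^ 2))) (cong (λ z → u ^ (3 * k) * z * p ^ (3 * k)) (^-distribʳ-* κ d L)) ⟨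
    (d * (L * p)) ^ κ + (d * (u * L ^ 2)) ^ κ + u ^ (3 * k) * (d * L) ^ κ * p ^ (3 * k)
      ≤⟨ +-mono-≤ (+-mono-≤ (^-monoˡ-≤ κ first) (^-monoˡ-≤ κ second)) (*-monoˡ-≤ (p ^ (3 * k)) (*-monoʳ-≤ (u ^ (3 * k)) (^-monoˡ-≤ κ dL≤H))) ⟩
    (H * p) ^ κ + (u * H ^ 2) ^ κ + u ^ (3 * k) * H ^ κ * p ^ (3 * k) ∎
    where
    open ≤-Reasoning
    κ = 4 * k
    L = H / d
    dL≤H = d*[H/d]≤H d H
    solve₁ : ∀ d x y u l q → d * (x + y + u * l * q) ≡ d * x + d * y + u * (d * l) * q
    solve₁ = solve-∀
    solve₂ : ∀ d u l → d * (u * (l * (l * 1))) ≡ u * (d * l * (l * 1))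
    solve₂ = solve-∀
    first : d * (L * p) ≤ H * p
    first = ≤-trans (≤-reflexive (sym (*-assoc d L p))) (*-monoˡ-≤ p dL≤H)
    second : d * (u * L ^ 2) ≤ u * H ^ 2
    second = ≤-trans (≤-reflexive (solve₂ d u L)) (*-monoʳ-≤ u (*-mono-≤ dL≤H (*-monoˡ-≤ 1 (≤-trans (m≤n*m L d) dL≤H))))

  -- Prepares the square root after working with 2k: a sum of squares is at most the square of the
  -- sum.
  rhs₂-double : ∀ u k → rhs₂ u p (k * 2) H ≤ rhs₂ u p k H ^ 2
  rhs₂-double u k = begin
    rhs₂ u p (k * 2) H ≡⟨ cong₂ _+_ (cong₂ _+_ (^-double (H * p) 4 k) (^-double (u * H ^ 2) 4 k))
      (cong₂ _*_ (cong₂ _*_ (^-double u 3 k) (^-double H 4 k)) (^-double p 3 k)) ⟩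
    A ^ 2 + B ^ 2 + a ^ 2 * b ^ 2 * c ^ 2 ≤⟨ m≤m+n _ (2 * (A * B + A * (a * b * c) + B * (a * b * c))) ⟩
    A ^ 2 + B ^ 2 + a ^ 2 * b ^ 2 * c ^ 2 + 2 * (A * B + A * (a * b * c) + B * (a * b * c)) ≡⟨ solve₁ A B a b c ⟩
    (A + B + a * b * c) ^ 2 ∎
    where
    open ≤-Reasoning
    A = (H * p) ^ (4 * k)
    B = (u * H ^ 2) ^ (4 * k)
    a = u ^ (3 * k)
    b = H ^ (4 * k)
    c = p ^ (3 * k)
    solve₁ : ∀ A B a b c → A * (A * 1) + B * (B * 1) + a * (a * 1) * (b * (b * 1)) * (c * (c * 1)) + 2 * (A * B + A * (a * b * c) + B * (a * b * c))
      ≡ (A + B + a * b * c) * ((A + B + a * b * c) * 1)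
    solve₁ = solve-∀

  part₂-small : ∀ k C T → 1 ≤ k → Prime p → 1 ≤ H → H < p → 1 ≤ T → T ^ (4 * (k * 2)) ≤ C * p →
    Residues.PowerBounds p 10 (4 * (k * 2)) T →
    InUnits p U → ∣ prodSet p U ∣ < 10 * ∣ U ∣ → ∣ U ∣ ^ 5 < p ^ 2 →
    (solCount p H U * p) ^ (4 * k)
      ≤ 2 * (4 * (k * 2)) ^ (4 * (k * 2)) * (1 + (4 ^ (4 * (k * 2)) + 27 ^ (4 * (k * 2))) * C) * p * rhs₂ ∣ U ∣ p k H
  part₂-small k C T 1≤k prime-p 1≤H H<p 1≤T T≤ bounds units small u< = ^-cancelˡ-≤ 2 (s≤s z≤n) (begin
    ((J * p) ^ (4 * k)) ^ 2 ≡⟨ ^-double (J * p) 4 k ⟨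
    (J * p) ^ e ≡⟨ ^-distribʳ-* e J p ⟩
    J ^ e * p ^ e ≤⟨ solCount-reduce H prime-p H<p 1≤H e (p ^ e) (D * p * rhs₂ u p (k * 2) H) 1≤e step ⟩
    2 * e ^ e * p * (D * p * rhs₂ u p (k * 2) H) ≡⟨ solve₁ (2 * e ^ e) D p (rhs₂ u p (k * 2) H) ⟩
    2 * e ^ e * D * (p ^ 2 * rhs₂ u p (k * 2) H) ≤⟨ *-mono-≤ (n≤n^ 2 (2 * e ^ e * D) (s≤s z≤n)) (*-monoʳ-≤ (p ^ 2) (rhs₂-double u k)) ⟩
    (2 * e ^ e * D) ^ 2 * (p ^ 2 * rhs₂ u p k H ^ 2) ≡⟨ solve₂ (2 * e ^ e * D) p (rhs₂ u p k H) ⟩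
    (2 * e ^ e * D * p * rhs₂ u p k H) ^ 2 ∎)
    where
    open ≤-Reasoning
    J = solCount p H U
    e = 4 * (k * 2)
    D = 1 + (4 ^ e + 27 ^ e) * C
    u = ∣ U ∣
    1≤k2 : 1 ≤ k * 2
    1≤k2 = *-positive 1≤k (s≤s z≤n)
    1≤e : 1 ≤ e
    1≤e = *-positive (s≤s (z≤n {3})) 1≤k2
    solve₁ : ∀ a d p r → a * p * (d * p * r) ≡ a * d * (p * (p * 1) * r)
    solve₁ = solve-∀
    solve₂ : ∀ a p r → a * (a * 1) * (p * (p * 1) * (r * (r * 1))) ≡ a * p * r * (a * p * r * 1)
    solve₂ = solve-∀
    step : ∀ d .{{_ : NonZero d}} → d ≤ H → (d * length (Residues.primitives p Us (H / d))) ^ e * p ^ e ≤ D * p * rhs₂ u p (k * 2) H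
    step d d≤H = begin
      (d * S) ^ e * p ^ e ≡⟨ ^-distribʳ-* e (d * S) p ⟨
      (d * S * p) ^ e ≡⟨ cong (_^ e) (*-assoc d S p) ⟩
      (d * (S * p)) ^ e ≡⟨ ^-distribʳ-* e d (S * p) ⟩
      d ^ e * (S * p) ^ e ≤⟨ *-monoʳ-≤ (d ^ e) (Bounds₂.primitiveBound₂ S T u p L (k * 2) C 1≤k2 1≤T T≤
        (λ m m≤e → subst (λ z → S ^ m * p ≤ T * z * (p + 2 * (L ^ m * L ^ m))) (length-elements U)
          (bounds Us (smallDoubling 10 units small) L m (m≥n⇒m/n>0 d≤H) (≤-trans L≤H (<⇒≤ H<p)) m≤e))
        (Residues.length-primitives p Us L) (∣p∣≤n U) u<) ⟩
      d ^ e * (D * p * rhs₂ u p (k * 2) L) ≡⟨ solve₃ (d ^ e) D p (rhs₂ u p (k * 2) L) ⟩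
      D * p * (d ^ e * rhs₂ u p (k * 2) L) ≤⟨ *-monoʳ-≤ (D * p) (rhs₂-scale u (k * 2) d) ⟩
      D * p * rhs₂ u p (k * 2) H ∎
      where
      L = H / d
      S = length (Residues.primitives p Us L)
      L≤H : L ≤ H
      L≤H = ≤-trans (m≤n*m L d) (d*[H/d]≤H d H)
      solve₃ : ∀ x d p r → x * (d * p * r) ≡ d * p * (x * r)
      solve₃ = solve-∀

-- The relation ≲ without real exponents: the k-th power with one factor `p` says J ≤ C^(1/k) H
-- p^(1/k), and `k` may exceed any 1/η. In (ii) a further factor `p` and the exponent 4k make 3/4
-- and 1/4 integral; the power of the sum is replaced by the sum of the powers, which agrees with it
-- up to a constant depending on `k`.
theorem1 : ((n : ℕ) → 1 ≤ n → (k : ℕ) → 1 ≤ k → Σ ℕ λ C →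
    (p : ℕ) → .{{_ : NonZero p}} → Prime p → (H : ℕ) → 1 ≤ H → (U : Subset p) →
    InUnits p U → ∣ prodSet p U ∣ < 10 * ∣ U ∣ →
    ∣ U ∣ ^ (2 * n + 1) < p ^ n → ∣ U ∣ * H ^ n < p →
    solCount p H U ^ k ≤ C * H ^ k * p)
    ×
    ((k : ℕ) → 1 ≤ k → Σ ℕ λ C →
    (p : ℕ) → .{{_ : NonZero p}} → Prime p → (H : ℕ) → 1 ≤ H → (U : Subset p) →
    InUnits p U → ∣ prodSet p U ∣ < 10 * ∣ U ∣ →
    ∣ U ∣ ^ 5 < p ^ 2 →
    (solCount p H U * p) ^ (4 * k)
    ≤ C * p * ((H * p) ^ (4 * k) + (∣ U ∣ * H ^ 2) ^ (4 * k)
    + ∣ U ∣ ^ (3 * k) * H ^ (4 * k) * p ^ (3 * k)))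
theorem1 = first , second
  where
  first : (n : ℕ) → 1 ≤ n → (k : ℕ) → 1 ≤ k → Σ ℕ λ C →
    (p : ℕ) → .{{_ : NonZero p}} → Prime p → (H : ℕ) → 1 ≤ H → (U : Subset p) →
    InUnits p U → ∣ prodSet p U ∣ < 10 * ∣ U ∣ →
    ∣ U ∣ ^ (2 * n + 1) < p ^ n → ∣ U ∣ * H ^ n < p →
    solCount p H U ^ k ≤ C * H ^ k * p
  first n 1≤n k 1≤k =
    let C , powers = primitivePowerBounds 10 (k * 2) (s≤s z≤n) (*-positive 1≤k (s≤s z≤n)) in
    2 * (k * 2) ^ (k * 2) * (1 + 3 ^ (k * 2) * C) , λ p prime-p H 1≤H U units small u< uH^n< →
      let T , _ , T≤ , bounds = powers p prime-p in
      part₁ p H U n k C T 1≤n 1≤k prime-p 1≤H T≤ bounds units small u< uH^n<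
  second : (k : ℕ) → 1 ≤ k → Σ ℕ λ C →
    (p : ℕ) → .{{_ : NonZero p}} → Prime p → (H : ℕ) → 1 ≤ H → (U : Subset p) →
    InUnits p U → ∣ prodSet p U ∣ < 10 * ∣ U ∣ →
    ∣ U ∣ ^ 5 < p ^ 2 →
    (solCount p H U * p) ^ (4 * k) ≤ C * p * rhs₂ ∣ U ∣ p k H
  second k 1≤k = C₁ + C₂ , main
    where
    e = 4 * (k * 2)
    losses = primitivePowerBounds 10 e (s≤s z≤n) (*-positive (s≤s (z≤n {3})) (*-positive 1≤k (s≤s (z≤n {1}))))
    C = proj₁ losses
    C₁ = 2 ^ (4 * k)
    C₂ = 2 * e ^ e * (1 + (4 ^ e + 27 ^ e) * C)
    main : (p : ℕ) → .{{_ : NonZero p}} → Prime p → (H : ℕ) → 1 ≤ H → (U : Subset p) →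
      InUnits p U → ∣ prodSet p U ∣ < 10 * ∣ U ∣ → ∣ U ∣ ^ 5 < p ^ 2 →
      (solCount p H U * p) ^ (4 * k) ≤ (C₁ + C₂) * p * rhs₂ ∣ U ∣ p k H
    main p prime-p H 1≤H U units small u< with H <? p
    ... | no H≮p = ≤-trans (part₂-large p H U k (≮⇒≥ H≮p))
      (*-monoˡ-≤ (rhs₂ ∣ U ∣ p k H) (*-monoˡ-≤ p (m≤m+n C₁ C₂)))
    ... | yes H<p = let T , 1≤T , T≤ , bounds = proj₂ losses p prime-p in
      ≤-trans (part₂-small p H U k C T 1≤k prime-p 1≤H H<p 1≤T T≤ bounds units small u<)
        (*-monoˡ-≤ (rhs₂ ∣ U ∣ p k H) (*-monoˡ-≤ p (m≤n+m C₂ C₁)))
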